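{- Let $h\ge 4$ and $r$ be positive integers and let $G$ be a graph with no $K_h$ minor. Then $\mathrm{pc}_r(G,k)\in O\big(h^{O(h)}\, r^{3h-3}\, k\big)$. That is, there exist absolute constants $C,c>0$ such that for all integers $h\ge 4$ and $r\ge 1$, every graph $G$ with no $K_h$ minor and every integer $k$ with $1\le k\le |V(G)|$, one has $\mathrm{pc}_r(G,k)\le C\, h^{ch}\, r^{3h-3}\, k$.
   Context: All graphs are finite, simple, loopless and undirected. $\mathrm{dist}(u,v)$ is the usual graph distance (number of edges of a shortest path, $+\infty$ if there is none). For an integer $r$, let $\mathrm{Cap}_r(\ell)=\ell$ if $\ell\le r$ and $\mathrm{Cap}_r(\ell)=+\infty$ otherwise. For $A\subseteq V(G)$ and $v\in V(G)$, the $r$-profile of $v$ with respect to $A$ is the function $p_r(v,A):A\to\mathbb N\cup\{+\infty\}$, $a\mapsto \mathrm{Cap}_r(\mathrm{dist}(a,v))$. Let $\mathrm{pc}_r(G,A)=\big|\{p_r(v,A): v\in V(G)\}\setminus\{a\mapsto+\infty\}\big|$ (the number of distinct $r$-profiles with respect to $A$, not counting the constant $+\infty$ profile), and let $\mathrm{pc}_r(G,k)=\max\{\mathrm{pc}_r(G,A): A\subseteq V(G), |A|=k\}$ (the $r$-profile complexity of $G$). -}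

module Defs where

open import Data.Empty using (⊥-elim)
open import Data.Fin using (Fin; zero; suc)
open import Data.Fin.Properties using (_≟_; any?; all?; injective⇒≤)
open import Data.Fin.Subset using (Subset; inside; outside; _∈_; ∣_∣; Nonempty)
open import Data.Fin.Subset.Properties using (_∈?_)
open import Data.List using (List; []; _∷_; _++_; head; last; length; lookup; map; filter; deduplicate; allFin)
open import Data.List.Extrema.Nat using (max)
import Data.List.Membership.Propositional as List
open import Data.List.Membership.Propositional.Properties using (∈-lookup; ∈-map⁺; ∈-++⁺ˡ; ∈-++⁺ʳ)
open import Data.List.Relation.Unary.All as All using (All)
open import Data.List.Relation.Unary.AllPairs using ([]; _∷_)
open import Data.List.Relation.Unary.Any using (here)
open import Data.List.Relation.Unary.Linked using (Linked; linked?)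
open import Data.List.Relation.Unary.Unique.Propositional using (Unique)
open import Data.List.Relation.Unary.Unique.DecPropositional using (unique?)
open import Data.Maybe using (just)
open import Data.Maybe.Properties using (≡-dec)
open import Data.Nat using (ℕ; zero; suc; _≤_; _<_; _≤?_)
import Data.Nat.Properties as ℕ
open import Data.Product using (∃; ∃₂; _×_; _,_; proj₁; proj₂)
open import Data.Sum using (_⊎_; inj₁; inj₂)
open import Data.Vec using ([]; _∷_)
open import Data.Vec.Properties.WithK using ([]=-irrelevant)
open import Function using (_∘_)
open import Relation.Binary using (Rel; Symmetric; Irreflexive)
import Relation.Binary as B
open import Relation.Binary.PropositionalEquality using (_≡_; _≢_; _≗_; refl; sym; cong; subst)
open import Relation.Nullary using (Dec; yes; no; ¬_; ¬?; does; map′; _×-dec_)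
open import Relation.Nullary.Construct.Add.Supremum using (_⁺; [_]; ⊤⁺)
open import Relation.Unary using (Pred; Decidable)
open import Data.Bool using (if_then_else_)
open import Level using (0ℓ)

record Graph (n : ℕ) : Set₁ where
  field
    Adj    : Rel (Fin n) 0ℓ
    symm   : Symmetric Adj
    irrefl : Irreflexive _≡_ Adj
    _adj?_ : B.Decidable Adj

complete : ∀ h → Graph h
complete h = record
  { Adj    = _≢_
  ; symm   = λ i≢j → i≢j ∘ sym
  ; irrefl = λ i≡j i≢j → i≢j i≡j
  ; _adj?_ = λ i j → ¬? (i ≟ j)
  }

module _ {n : ℕ} (G : Graph n) where
  open Graph G using (Adj; _adj?_)

  record IsPath (u v : Fin n) (xs : List (Fin n)) : Set where
    field
      starts : head xs ≡ just u
      ends   : last xs ≡ just v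
      linked : Linked Adj xs
      unique : Unique xs

  -- A path is the list of its vertices, so its length is one less than that of
  -- the list.
  HasPath : Fin n → Fin n → ℕ → Set
  HasPath u v ℓ = ∃ λ xs → length xs ≡ suc ℓ × IsPath u v xs

  IsDistance : Fin n → Fin n → ℕ ⁺ → Set
  IsDistance u v [ ℓ ] = HasPath u v ℓ × (∀ m → HasPath u v m → ℓ ≤ m)
  IsDistance u v ⊤⁺    = ∀ m → ¬ HasPath u v m

  isPath? : ∀ u v → Decidable (IsPath u v)
  isPath? u v xs = map′
    (λ (s , e , l , q) → record { starts = s ; ends = e ; linked = l ; unique = q })
    (λ p → let open IsPath p in starts , ends , linked , unique)
    (≡-dec _≟_ (head xs) (just u) ×-dec ≡-dec _≟_ (last xs) (just v)
      ×-dec linked? _adj?_ xs ×-dec unique? _≟_ xs)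

anyList? : ∀ {n} ℓ {P : Pred (List (Fin n)) 0ℓ} → Decidable P →
           Dec (∃ λ xs → length xs ≡ ℓ × P xs)
anyList? zero    P? = map′ (λ p → [] , refl , p) (λ { ([] , refl , p) → p }) (P? [])
anyList? (suc ℓ) P? = map′
  (λ { (x , xs , eq , p) → x ∷ xs , cong suc eq , p })
  (λ { (x ∷ xs , eq , p) → x , xs , ℕ.suc-injective eq , p })
  (any? λ x → anyList? ℓ (P? ∘ (x ∷_)))

least : ∀ {P : Pred ℕ 0ℓ} → Decidable P → ∀ N →
        (∃ λ ℓ → P ℓ × (∀ m → P m → ℓ ≤ m)) ⊎ (∀ m → m < N → ¬ P m)
least P? zero = inj₂ λ _ ()
least {P} P? (suc N) with least P? N
... | inj₁ found = inj₁ found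
... | inj₂ none with P? N
...   | yes p = inj₁ (N , p , λ m q → ℕ.≮⇒≥ λ m<N → none m m<N q)
...   | no ¬p = inj₂ λ m m<1+N q → split m (q , ℕ.m<1+n⇒m<n∨m≡n m<1+N)
  where
  split : ∀ m → ¬ (P m × (m < N ⊎ m ≡ N))
  split m (q , inj₁ m<N)  = none m m<N q
  split m (q , inj₂ refl) = ¬p q

unique⇒length≤ : ∀ {n} (xs : List (Fin n)) → Unique xs → length xs ≤ n
unique⇒length≤ xs unq = injective⇒≤ (λ {i} {j} → lookup-injective xs unq i j)
  where
  lookup-injective : ∀ {n} (ys : List (Fin n)) → Unique ys →
                     ∀ i j → lookup ys i ≡ lookup ys j → i ≡ j
  lookup-injective (y ∷ ys) (y∉ ∷ _) zero    zero    eq = refl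
  lookup-injective (y ∷ ys) (y∉ ∷ _) zero    (suc j) eq = ⊥-elim (All.lookup y∉ (∈-lookup j) eq)
  lookup-injective (y ∷ ys) (y∉ ∷ _) (suc i) zero    eq = ⊥-elim (All.lookup y∉ (∈-lookup i) (sym eq))
  lookup-injective (y ∷ ys) (_ ∷ q)  (suc i) (suc j) eq = cong suc (lookup-injective ys q i j eq)

module _ {n : ℕ} (G : Graph n) where

  distance : ∀ u v → ∃ (IsDistance G u v)
  distance u v with least (λ ℓ → anyList? (suc ℓ) (isPath? G u v)) n
  ... | inj₁ (ℓ , shortest) = [ ℓ ] , shortest
  ... | inj₂ none           = ⊤⁺ , λ m (xs , eq , p) →
    none m (subst (_≤ n) eq (unique⇒length≤ xs (IsPath.unique p))) (xs , eq , p)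

  dist : Fin n → Fin n → ℕ ⁺
  dist u v = proj₁ (distance u v)

  Connected : Subset n → Set
  Connected S = Nonempty S ×
    (∀ u v → u ∈ S → v ∈ S → ∃ λ xs → IsPath G u v xs × All (_∈ S) xs)

-- H ≼ G: the graph H is a minor of G, witnessed by a family of branch sets.
record _≼_ {m n : ℕ} (H : Graph m) (G : Graph n) : Set where
  field
    branch    : Fin m → Subset n
    connected : ∀ i → Connected G (branch i)
    disjoint  : ∀ i j v → v ∈ branch i → v ∈ branch j → i ≡ j
    edges     : ∀ i j → Graph.Adj H i j →
                ∃₂ λ u v → u ∈ branch i × v ∈ branch j × Graph.Adj G u v

Cap : ℕ → ℕ ⁺ → ℕ ⁺
Cap r [ ℓ ] = if does (ℓ ≤? r) then [ ℓ ] else ⊤⁺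
Cap r ⊤⁺    = ⊤⁺

-- Functions A → ℕ ∪ {+∞}, compared pointwise.
Profile : ∀ {n} → Subset n → Set
Profile A = ∃ (_∈ A) → ℕ ⁺

_≗?_ : ∀ {n} {A : Subset n} → B.Decidable (_≗_ {A = ∃ (_∈ A)} {B = ℕ ⁺})
_≗?_ {n} {A} p q = map′ (λ f (a , a∈A) → f a a∈A) (λ f a a∈A → f (a , a∈A)) (all? agree?)
  where
  agree? : (a : Fin n) → Dec (∀ a∈A → p (a , a∈A) ≡ q (a , a∈A))
  agree? a with a ∈? A
  ... | no  a∉A = yes λ a∈A → ⊥-elim (a∉A a∈A)
  ... | yes a∈A = map′
    (λ eq a∈A′ → subst (λ e → p (a , e) ≡ q (a , e)) ([]=-irrelevant a∈A a∈A′) eq)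
    (λ f → f a∈A)
    (≡-dec ℕ._≟_ (p (a , a∈A)) (q (a , a∈A)))

subsets : ∀ n → List (Subset n)
subsets zero    = [] ∷ []
subsets (suc n) = map (outside ∷_) (subsets n) ++ map (inside ∷_) (subsets n)

∈-subsets : ∀ {n} (A : Subset n) → A List.∈ subsets n
∈-subsets []            = here refl
∈-subsets (outside ∷ A) = ∈-++⁺ˡ (∈-map⁺ (outside ∷_) (∈-subsets A))
∈-subsets {suc n} (inside ∷ A) =
  ∈-++⁺ʳ (map (outside ∷_) (subsets n)) (∈-map⁺ (inside ∷_) (∈-subsets A))

module _ (r : ℕ) {n : ℕ} (G : Graph n) where

  profile : Fin n → (A : Subset n) → Profile A
  profile v A (a , _) = Cap r (dist G a v)

  pcₛ : Subset n → ℕ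
  pcₛ A = length (deduplicate _≗?_ (filter (λ p → ¬? (p ≗? λ _ → ⊤⁺))
            (map (λ v → profile v A) (allFin n))))

  -- The first argument of max is its value on the empty list, which is only
  -- reached when k > n.
  pc : ℕ → ℕ
  pc k = max 0 (map pcₛ (filter (λ A → ∣ A ∣ ℕ.≟ k) (subsets n)))

{-# OPTIONS --safe #-}
module Submission where

-- Decompose G by repeatedly removing from the current component C a connected set H, the union of
-- at most h − 2 geodesics of C from a common root, reaching every earlier such set adjacent to C. Those
-- earlier sets together with C form a clique minor, so there are at most h − 2 of them.
-- For v near A, let C be the last component of its chain in which v still sees A within
-- distance r. Some x ∈ H lies on a short walk of C from v to some a ∈ A, and the part of H and of the
-- earlier adjacent sets within distance 2r of x meets every short walk from v to A. Hence the
-- profile of v is determined by the pair (a , x) and the profile of v on a set of O(h² r) vertices.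
-- There are O(h (2r)^(h-1)) choices of x for each a (a bound on weak colouring numbers), and
-- O(h² r²)^(h-1) profiles on the guard set by the Sauer–Shelah lemma: a family of h balls that shatters
-- yields a K_h minor through its power diagram.

open import Defs
open import Data.Nat using (ℕ; _≤_; _≥_; _>_; _*_; _∸_; _^_)
open import Data.Product using (∃₂; _×_)
open import Relation.Nullary using (¬_)

open import Data.Bool using (Bool; true; false)
import Data.Bool.Properties as Bool
open import Data.Fin as Fin using (Fin; zero; suc)
import Data.Fin.Properties as Fin
open import Data.Fin.Subset as Subset using (Subset)
open import Data.Fin.Subset.Properties using (_∈?_; nonempty?; ∉⊥; p⊂q⇒∣p∣<∣q∣; ∣p∣≤n)
open import Data.List as List
  using (List; []; _∷_; _++_; [_]; length; map; head; last; lookup; filter; take; deduplicate; allFin;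
         upTo; downFrom; applyDownFrom; cartesianProduct)
open import Data.List.Extrema.Nat using (max≤v⁺)
import Data.List.Membership.DecPropositional as DecMembership
open import Data.List.Membership.Propositional using (_∈_; _∉_; find; lose)
open import Data.List.Membership.Propositional.Properties
  using (∈-map⁺; ∈-map⁻; ∈-++⁺ˡ; ∈-++⁺ʳ; ∈-++⁻; ∈-∃++; ∈-filter⁺; ∈-filter⁻; ∈-lookup; ∈-upTo⁺;
         ∈-downFrom⁺; ∈-downFrom⁻; ∈-applyDownFrom⁺; ∈-cartesianProduct⁺)
open import Data.List.Properties using (length-map; length-++; length-take; length-upTo)
open import Data.List.Relation.Unary.All as All using (All; []; _∷_)
import Data.List.Relation.Unary.All.Properties as All
open import Data.List.Relation.Unary.AllPairs using (AllPairs; []; _∷_)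
import Data.List.Relation.Unary.AllPairs.Properties as AllPairs
open import Data.List.Relation.Unary.Any as Any using (Any; here; there)
open import Data.List.Relation.Unary.Linked using (Linked; [-]; _∷_)
open import Data.List.Relation.Unary.Unique.Propositional using (Unique)
open import Data.Maybe using (just)
open import Data.Nat using (zero; suc; _+_; _<_; z≤n; s≤s; _≟_; _≤?_; _<?_)
open import Data.Nat.Properties
open import Data.Nat.Tactic.RingSolver using (solve-∀)
open import Data.Product using (∃; Σ; _,_; proj₁; proj₂)
open import Data.Sum using (_⊎_; inj₁; inj₂; map₂; swap)
open import Data.Unit using (⊤; tt)
open import Data.Vec as Vec using (Vec; []; _∷_)
import Data.Vec.Properties as Vec
open import Function using (_∘_)
open import Function.Bundles using (_⇔_; mk⇔)
open import Level using (0ℓ)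
open import Relation.Binary using (Decidable; tri<; tri≈; tri>)
open import Relation.Binary.PropositionalEquality
  using (_≡_; _≢_; _≗_; refl; sym; trans; cong; cong₂; subst; subst₂)
open import Relation.Nullary using (Dec; yes; no; ¬?; does; map′; _×-dec_; _⊎-dec_; contradiction)
open import Relation.Nullary.Construct.Add.Supremum using (⊤⁺) renaming ([_] to [_]⁺)
open import Relation.Nullary.Decidable using (dec-true; dec-false; does-⇔; decidable-stable; toSum)
open import Relation.Unary as U using (Pred)

-- Upper bounds on cardinalities and the pigeonhole principle

-- The list may also hold elements outside `P`, so a bound passes to smaller predicates that need
-- not be decidable.
Cover : ∀ {A : Set} → (A → Set) → ℕ → Set
Cover P N = ∃ λ xs → length xs ≤ N × (∀ {x} → P x → x ∈ xs)

cover-⊆ : ∀ {A : Set} {P Q : A → Set} {M N} → M ≤ N → (∀ {x} → Q x → P x) → Cover P M → Cover Q N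
cover-⊆ M≤N Q⊆P (xs , len , cov) = xs , ≤-trans len M≤N , cov ∘ Q⊆P

cover-∪ : ∀ {A : Set} {P Q : A → Set} {M N} → Cover P M → Cover Q N → Cover (λ x → P x ⊎ Q x) (M + N)
cover-∪ {P = P} {Q} (xs , lx , cx) (ys , ly , cy) =
  xs ++ ys , ≤-trans (≤-reflexive (length-++ xs)) (+-mono-≤ lx ly) , cov
  where
  cov : ∀ {x} → P x ⊎ Q x → x ∈ xs ++ ys
  cov (inj₁ p) = ∈-++⁺ˡ (cx p)
  cov (inj₂ q) = ∈-++⁺ʳ xs (cy q)

cover-image : ∀ {A B : Set} {P : A → Set} {N} (f : A → B) → Cover P N →
              Cover (λ y → ∃ λ x → P x × y ≡ f x) N
cover-image f (xs , len , cov) =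
  map f xs , ≤-trans (≤-reflexive (length-map f xs)) len , λ { (x , p , refl) → ∈-map⁺ f (cov p) }

cover-list : ∀ {A B : Set} {Q : A → B → Set} {N} (xs : List A) → (∀ x → Cover (Q x) N) →
             Cover (λ y → ∃ λ x → x ∈ xs × Q x y) (length xs * N)
cover-list [] f = [] , z≤n , λ { (_ , () , _) }
cover-list {Q = Q} (x ∷ xs) f = cover-⊆ ≤-refl split (cover-∪ (f x) (cover-list xs f))
  where
  split : ∀ {y} → (∃ λ z → z ∈ x ∷ xs × Q z y) → Q x y ⊎ (∃ λ z → z ∈ xs × Q z y)
  split (_ , here refl , q) = inj₁ q
  split (z , there z∈ , q)  = inj₂ (z , z∈ , q)

cover-bind : ∀ {A B : Set} {P : A → Set} {Q : A → B → Set} {M N} → Cover P M → (∀ x → Cover (Q x) N) →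
             Cover (λ y → ∃ λ x → P x × Q x y) (M * N)
cover-bind {N = N} (xs , len , cov) f =
  cover-⊆ (*-monoˡ-≤ N len) (λ (x , p , q) → x , cov p , q) (cover-list xs f)

cover-when : ∀ {A P : Set} {Q : A → Set} {N} → Dec P → (P → Cover Q N) → Cover (λ x → P × Q x) N
cover-when (yes p) f = cover-⊆ ≤-refl proj₂ (f p)
cover-when (no ¬p) f = [] , z≤n , λ (p , _) → contradiction p ¬p

length-remove : ∀ {A : Set} (ys : List A) {x zs} → length (ys ++ x ∷ zs) ≡ suc (length (ys ++ zs))
length-remove []       = refl
length-remove (_ ∷ ys) = cong suc (length-remove ys)

∈-remove : ∀ {A : Set} (ys : List A) {x y zs} → y ∈ ys ++ x ∷ zs → y ≢ x → y ∈ ys ++ zs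
∈-remove ys {zs = zs} y∈ y≢x with ∈-++⁻ ys y∈
... | inj₁ y∈ys         = ∈-++⁺ˡ y∈ys
... | inj₂ (here y≡x)   = contradiction y≡x y≢x
... | inj₂ (there y∈zs) = ∈-++⁺ʳ ys y∈zs

cover-∖ : ∀ {A : Set} {P : A → Set} {N} x → P x → Cover P (suc N) → Cover (λ y → P y × y ≢ x) N
cover-∖ x p (xs , len , cov) with ∈-∃++ (cov p)
... | ys , zs , refl = ys ++ zs , ≤-pred (≤-trans (≤-reflexive (sym (length-remove ys))) len) ,
  λ (q , y≢x) → ∈-remove ys (cov q) y≢x

-- Keys are attached by a relation and elements are told apart only up to `_≈_`: a profile is a
-- function, compared pointwise, and its key depends on the choice of a vertex that has this
-- profile.
pigeonhole : ∀ {A K : Set} {ℓ} {_≈_ : A → A → Set ℓ} {Key : A → K → Set} {N} →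
             (∀ {x y κ} → Key x κ → Key y κ → x ≈ y) →
             (P : K → Set) → Cover P N → (xs : List A) → AllPairs (λ x y → ¬ x ≈ y) xs →
             All (λ x → ∃ λ κ → P κ × Key x κ) xs → length xs ≤ N
pigeonhole inj P _ [] _ _ = z≤n
pigeonhole {N = zero} inj P (κs , len , cov) (x ∷ xs) _ ((κ , p , _) ∷ _)
  with [] ← κs with () ← cov p
pigeonhole {_≈_ = _≈_} {Key} {suc N} inj P c (x ∷ xs) (x≉ ∷ distinct) ((κ , p , key) ∷ keys) =
  s≤s (pigeonhole inj _ (cover-∖ κ p c) xs distinct (All.zipWith other (x≉ , keys)))
  where
  other : ∀ {y} → ¬ x ≈ y × (∃ λ κ′ → P κ′ × Key y κ′) → ∃ λ κ′ → (P κ′ × κ′ ≢ κ) × Key y κ′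
  other (x≉y , κ′ , p′ , key′) = κ′ , (p′ , λ { refl → x≉y (inj key key′) }) , key′

-- The Sauer-Shelah lemma

-- Repeated positions are allowed, but a tuple with a repetition is never shattered, since some
-- pattern differs at the two places.
Shatters : ∀ {m d} → (Vec Bool m → Set) → Vec (Fin m) d → Set
Shatters F is = ∀ p → ∃ λ x → F x × Vec.map (Vec.lookup x) is ≡ p

-- The sum of the binomial coefficients `m` over `i` for `i < d`, computed by Pascal's rule.
sauer : ℕ → ℕ → ℕ
sauer m       zero    = 0
sauer zero    (suc d) = 1
sauer (suc m) (suc d) = sauer m (suc d) + sauer m d

sauer≤ : ∀ m d → sauer m (suc d) ≤ suc m ^ d
sauer≤ zero    d       = ≤-reflexive (sym (^-zeroˡ d))
sauer≤ (suc m) zero    = ≤-trans (≤-reflexive (+-identityʳ _)) (sauer≤ m zero)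
sauer≤ (suc m) (suc d) = begin
  sauer m (2 + d) + sauer m (suc d)   ≤⟨ +-mono-≤ (sauer≤ m (suc d)) (sauer≤ m d) ⟩
  suc m * suc m ^ d + suc m ^ d       ≡⟨ +-comm _ (suc m ^ d) ⟩
  (2 + m) * suc m ^ d                 ≤⟨ *-monoʳ-≤ (2 + m) (^-monoˡ-≤ d (n≤1+n (suc m))) ⟩
  (2 + m) * (2 + m) ^ d               ∎
  where open ≤-Reasoning

map-lookup-suc : ∀ {m d} (b : Bool) (x : Vec Bool m) (is : Vec (Fin m) d) →
                 Vec.map (Vec.lookup (b ∷ x)) (Vec.map suc is) ≡ Vec.map (Vec.lookup x) is
map-lookup-suc b x []       = refl
map-lookup-suc b x (i ∷ is) = cong (Vec.lookup x i ∷_) (map-lookup-suc b x is)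

-- Split on the first bit: `F∪` forgets it, and `F∩` keeps the words for which both values occur. A
-- tuple shattered by `F∩` is shattered by `F` with the first position added, so `F∩` shatters one
-- position less. Each word of `F` is the least extension of a word of `F∪` or the `true` extension
-- of a word of `F∩`.
sauer-shelah : ∀ m d (F : Vec Bool m → Set) → U.Decidable F →
               (∀ (is : Vec (Fin m) d) → ¬ Shatters F is) → Cover F (sauer m d)
sauer-shelah m zero F F? none = [] , z≤n , λ {x} Fx → contradiction (λ { [] → x , Fx , refl }) (none [])
sauer-shelah zero (suc d) F F? none = [ [] ] , s≤s z≤n , λ { {[]} _ → here refl }
sauer-shelah (suc m) (suc d) F F? none =
  cover-⊆ ≤-refl covered (cover-∪
    (cover-image least-extension (sauer-shelah m (suc d) F∪ (λ x → F? (false ∷ x) ⊎-dec F? (true ∷ x))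
      (λ is → none (Vec.map suc is) ∘ shatters∪ is)))
    (cover-image (true ∷_) (sauer-shelah m d F∩ (λ x → F? (false ∷ x) ×-dec F? (true ∷ x))
      (λ is → none (zero ∷ Vec.map suc is) ∘ shatters∩ is))))
  where
  F∪ F∩ : Vec Bool m → Set
  F∪ x = F (false ∷ x) ⊎ F (true ∷ x)
  F∩ x = F (false ∷ x) × F (true ∷ x)

  shatters∪ : ∀ {e} (is : Vec (Fin m) e) → Shatters F∪ is → Shatters F (Vec.map suc is)
  shatters∪ is sh p with sh p
  ... | x , inj₁ Fx , eq = false ∷ x , Fx , trans (map-lookup-suc false x is) eq
  ... | x , inj₂ Fx , eq = true ∷ x , Fx , trans (map-lookup-suc true x is) eq

  shatters∩ : ∀ {e} (is : Vec (Fin m) e) → Shatters F∩ is → Shatters F (zero ∷ Vec.map suc is)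
  shatters∩ is sh (b ∷ p) with sh p
  shatters∩ is sh (false ∷ p) | x , (F0 , _) , eq = false ∷ x , F0 , cong (false ∷_) (trans (map-lookup-suc false x is) eq)
  shatters∩ is sh (true ∷ p)  | x , (_ , F1) , eq = true ∷ x , F1 , cong (true ∷_) (trans (map-lookup-suc true x is) eq)

  least-extension : Vec Bool m → Vec Bool (suc m)
  least-extension x with F? (false ∷ x)
  ... | yes _ = false ∷ x
  ... | no  _ = true ∷ x

  covered : ∀ {x} → F x → (∃ λ y → F∪ y × x ≡ least-extension y) ⊎ (∃ λ y → F∩ y × x ≡ true ∷ y)
  covered {false ∷ x} Fx = inj₁ (x , inj₁ Fx , eq)
    where
    eq : false ∷ x ≡ least-extension x
    eq with F? (false ∷ x)
    ... | yes _  = refl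
    ... | no ¬F0 = contradiction Fx ¬F0
  covered {true ∷ x} Fx with F? (false ∷ x) in eq
  ... | yes F0 = inj₂ (x , (F0 , Fx) , refl)
  ... | no  _  = inj₁ (x , inj₂ Fx , eq′)
    where
    eq′ : true ∷ x ≡ least-extension x
    eq′ rewrite eq = refl

-- Descending paths in an elimination order

module Descent (J : ℕ → ℕ → Set) (J? : Decidable J) (J⇒< : ∀ {i j} → J i j → j < i)
  (clique : ∀ {i j k} → J i j → J i k → j < k → J k j) where

  -- `J i j` makes `j` a back-neighbour of `i`, and by `clique` the back-neighbours of `i` are
  -- pairwise related, as in an elimination order of a chordal graph. The index `ℓ` is an upper
  -- bound on the number of steps.
  data Descends : ℕ → ℕ → ℕ → Set where
    here : ∀ {ℓ i} → Descends ℓ i i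
    down : ∀ {ℓ i j k} → J i k → Descends ℓ k j → Descends (suc ℓ) i j

  descends⇒≤ : ∀ {ℓ i j} → Descends ℓ i j → j ≤ i
  descends⇒≤ here       = ≤-refl
  descends⇒≤ (down e p) = ≤-trans (descends⇒≤ p) (<⇒≤ (J⇒< e))

  weaken : ∀ {ℓ i j} → Descends ℓ i j → Descends (suc ℓ) i j
  weaken here       = here
  weaken (down e p) = down e (weaken p)

  -- If the first step `k` lies below `q`, both are back-neighbours of `i` and `clique` leads from
  -- `q` straight to `k`. If it lies above, `q` is a back-neighbour of `k` and the argument repeats
  -- from there.
  reroute : ∀ {ℓ i j q} → J i q → j ≤ q → Descends ℓ i j → Descends ℓ q j
  reroute Jiq j≤q here = contradiction (J⇒< Jiq) (≤⇒≯ j≤q)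
  reroute {q = q} Jiq j≤q (down {k = k} Jik p) with <-cmp k q
  ... | tri< k<q _ _  = down (clique Jik Jiq k<q) p
  ... | tri≈ _ refl _ = weaken p
  ... | tri> _ _ q<k  = weaken (reroute (clique Jiq Jik q<k) j≤q p)

  -- Targets up to the least back-neighbour q of i are one step closer to q;
  -- those above q live among the vertices whose back-neighbours include q, where the
  -- back-degree has dropped.
  descent-cover : ∀ r k b (P : ℕ → Set) → (∀ {i j} → P i → J i j → b ≤ j → P j) →
                  (∀ {i} → P i → Cover (λ j → J i j × b ≤ j) k) →
                  ∀ {i} → P i → Cover (λ j → b ≤ j × Descends r i j) (suc r ^ k)
  descent-cover r k b P hered deg {i} Pi with least (λ j → J? i j ×-dec (b ≤? j)) i
  ... | inj₂ none = [ i ] , m^n>0 (suc r) k , λ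
    { (_ , here) → here refl
    ; (b≤j , down Jik p) → contradiction (Jik , ≤-trans b≤j (descends⇒≤ p)) (none _ (J⇒< Jik)) }
  descent-cover zero k b P hered deg {i} Pi | inj₁ _ =
    [ i ] , m^n>0 1 k , λ { (_ , here) → here refl }
  descent-cover (suc r) zero b P hered deg {i} Pi | inj₁ (q , Jq , _)
    with [] , _ , cov ← deg Pi with () ← cov Jq
  descent-cover (suc r) (suc k) b P hered deg {i} Pi | inj₁ (q , (Jiq , b≤q) , q-least) =
    cover-⊆ size split (cover-∪
      (descent-cover r (suc k) b P hered deg (hered Pi Jiq b≤q))
      (descent-cover (suc r) k (suc q) (λ x → P x × J x q)
        (λ (Px , Jxq) Jxj q<j → hered Px Jxj (≤-trans b≤q (<⇒≤ q<j)) , clique Jxq Jxj q<j)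
        (λ (Px , Jxq) → cover-⊆ ≤-refl
          (λ (Jxj , q<j) → (Jxj , ≤-trans b≤q (<⇒≤ q<j)) , λ { refl → n≮n _ q<j })
          (cover-∖ q (Jxq , b≤q) (deg Px)))
        (Pi , Jiq)))
    where
    size : suc r ^ suc k + (2 + r) ^ k ≤ (2 + r) ^ suc k
    size = begin
      suc r * suc r ^ k + (2 + r) ^ k   ≤⟨ +-monoˡ-≤ _ (*-monoʳ-≤ (suc r) (^-monoˡ-≤ k (n≤1+n (suc r)))) ⟩
      suc r * (2 + r) ^ k + (2 + r) ^ k ≡⟨ +-comm _ ((2 + r) ^ k) ⟩
      (2 + r) * (2 + r) ^ k             ∎
      where open ≤-Reasoning

    lower : ∀ {j} → b ≤ j → j ≤ q → Descends (suc r) i j → Descends r q j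
    lower b≤j j≤q here = contradiction (J⇒< Jiq) (≤⇒≯ j≤q)
    -- As `q` is the least candidate, the first step lands at `q` or above; from above, `reroute`
    -- lets the remaining `r` steps start at `q` instead.
    lower b≤j j≤q (down {k = p} Jip path) with m≤n⇒m<n∨m≡n (q-least p (Jip , ≤-trans b≤j (descends⇒≤ path)))
    ... | inj₂ refl = path
    ... | inj₁ q<p  = reroute (clique Jiq Jip q<p) j≤q path

    split : ∀ {j} → b ≤ j × Descends (suc r) i j →
            (b ≤ j × Descends r q j) ⊎ (suc q ≤ j × Descends (suc r) i j)
    split {j} (b≤j , path) with j ≤? q
    ... | yes j≤q = inj₁ (b≤j , lower b≤j j≤q path)
    ... | no  j≰q = inj₂ (≰⇒> j≰q , path)

-- Subsets given by decidable predicates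

module _ {n : ℕ} where

  ⟦_⟧ : {P : Pred (Fin n) 0ℓ} → U.Decidable P → Subset n
  ⟦ P? ⟧ = Vec.tabulate (does ∘ P?)

  module _ {P : Pred (Fin n) 0ℓ} (P? : U.Decidable P) where

    ∈⟦⟧⁺ : ∀ {v} → P v → v Subset.∈ ⟦ P? ⟧
    ∈⟦⟧⁺ {v} p = Vec.lookup⇒[]= v _ (trans (Vec.lookup∘tabulate _ v) (dec-true (P? v) p))

    ∈⟦⟧⁻ : ∀ {v} → v Subset.∈ ⟦ P? ⟧ → P v
    ∈⟦⟧⁻ {v} v∈ with P? v | trans (sym (Vec.lookup∘tabulate (does ∘ P?) v)) (Vec.[]=⇒lookup v∈)
    ... | yes p | _ = p

  ⟦⟧-cong : {P Q : Pred (Fin n) 0ℓ} (P? : U.Decidable P) (Q? : U.Decidable Q) →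
            (∀ v → P v ⇔ Q v) → ⟦ P? ⟧ ≡ ⟦ Q? ⟧
  ⟦⟧-cong P? Q? P⇔Q = Vec.tabulate-cong λ v → does-⇔ (P⇔Q v) (P? v) (Q? v)

-- Walks, paths and distances

module Walks {n : ℕ} (G : Graph n) where
  open Graph G public
  private V = Fin n

  -- ℓ is only an upper bound on the number of edges.
  data Walk (P : Pred V 0ℓ) : V → V → ℕ → Set where
    stop : ∀ {u ℓ} → P u → Walk P u u ℓ
    step : ∀ {u v w ℓ} → P u → Adj u w → Walk P w v ℓ → Walk P u v (suc ℓ)

  Full : Pred V 0ℓ
  Full _ = ⊤

  module _ {P : Pred V 0ℓ} where

    start∈ : ∀ {u v ℓ} → Walk P u v ℓ → P u
    start∈ (stop p)     = p
    start∈ (step p _ _) = p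

    end∈ : ∀ {u v ℓ} → Walk P u v ℓ → P v
    end∈ (stop p)     = p
    end∈ (step _ _ w) = end∈ w

    lengthen : ∀ {u v ℓ m} → ℓ ≤ m → Walk P u v ℓ → Walk P u v m
    lengthen _         (stop p)      = stop p
    lengthen (s≤s ℓ≤m) (step p e w) = step p e (lengthen ℓ≤m w)

    _◅◅_ : ∀ {u v w ℓ m} → Walk P u v ℓ → Walk P v w m → Walk P u w (ℓ + m)
    _◅◅_ {ℓ = ℓ} (stop _)     w′ = lengthen (m≤n+m _ ℓ) w′
    _◅◅_         (step p e w) w′ = step p e (w ◅◅ w′)

    reverse : ∀ {u v ℓ} → Walk P u v ℓ → Walk P v u ℓ
    reverse (stop p) = stop p
    reverse {ℓ = suc ℓ} (step p e w) =
      subst (Walk P _ _) (+-comm ℓ 1) (reverse w ◅◅ step (start∈ w) (symm e) (stop p))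

    walk? : U.Decidable P → ∀ u v ℓ → Dec (Walk P u v ℓ)
    walk? P? u v ℓ with P? u | u Fin.≟ v
    ... | no ¬p | _        = no (¬p ∘ start∈)
    ... | yes p | yes refl = yes (stop p)
    walk? P? u v zero    | yes p | no u≢v = no λ { (stop _) → u≢v refl }
    walk? P? u v (suc ℓ) | yes p | no u≢v = map′
      (λ (w , e , π) → step p e π)
      (λ { (stop _) → contradiction refl u≢v ; (step _ e π) → _ , e , π })
      (Fin.any? λ w → (u adj? w) ×-dec walk? P? w v ℓ)

  walk-⊆ : ∀ {P Q : Pred V 0ℓ} → (∀ {v} → P v → Q v) → ∀ {u v ℓ} → Walk P u v ℓ → Walk Q u v ℓ
  walk-⊆ P⊆Q (stop p)     = stop (P⊆Q p)
  walk-⊆ P⊆Q (step p e w) = step (P⊆Q p) e (walk-⊆ P⊆Q w)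

  data Path : V → V → List V → Set where
    single : ∀ {u} → Path u u [ u ]
    cons   : ∀ {u v w xs} → Adj u w → Path w v xs → u ∉ xs → Path u v (u ∷ xs)

  open DecMembership (Fin._≟_ {n}) public using () renaming (_∈?_ to _∈ₗ?_)

  path-from : ∀ {P : Pred V 0ℓ} {u w v xs} → Path w v xs → All P xs → u ∈ xs →
              ∃ λ ys → Path u v ys × All P ys × length ys ≤ length xs
  path-from π@single       ps       (here refl) = _ , π , ps , ≤-refl
  path-from π@(cons _ _ _) ps       (here refl) = _ , π , ps , ≤-refl
  path-from (cons _ π _)   (_ ∷ ps) (there u∈) with path-from π ps u∈
  ... | ys , ρ , qs , len = ys , ρ , qs , m≤n⇒m≤1+n len

  walk⇒path : ∀ {P : Pred V 0ℓ} {u v ℓ} → Walk P u v ℓ →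
              ∃ λ xs → Path u v xs × All P xs × length xs ≤ suc ℓ
  walk⇒path (stop p) = _ , single , p ∷ [] , s≤s z≤n
  walk⇒path {u = u} (step p e w) with walk⇒path w
  ... | xs , π , ps , len with u ∈ₗ? xs
  ...   | no u∉ = u ∷ xs , cons e π u∉ , p ∷ ps , s≤s len
  ...   | yes u∈ with path-from π ps u∈
  ...     | ys , ρ , qs , len′ = ys , ρ , qs , m≤n⇒m≤1+n (≤-trans len′ len)

  path⇒IsPath : ∀ {u v xs} → Path u v xs → IsPath G u v xs
  path⇒IsPath π = record { starts = starts π ; ends = ends π ; linked = linked π ; unique = unique π }
    where
    starts : ∀ {u v xs} → Path u v xs → head xs ≡ just u
    starts single       = refl
    starts (cons _ _ _) = refl
    ends : ∀ {u v xs} → Path u v xs → last xs ≡ just v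
    ends single                    = refl
    ends (cons _ single _)         = refl
    ends (cons _ π@(cons _ _ _) _) = ends π
    linked : ∀ {u v xs} → Path u v xs → Linked Adj xs
    linked single                    = [-]
    linked (cons e single _)         = e ∷ [-]
    linked (cons e π@(cons _ _ _) _) = e ∷ linked π
    unique : ∀ {u v xs} → Path u v xs → Unique xs
    unique single        = [] ∷ []
    unique (cons _ π u∉) = All.¬Any⇒All¬ _ u∉ ∷ unique π

  IsPath⇒walk : ∀ {u v xs ℓ} → IsPath G u v xs → length xs ≡ suc ℓ → Walk Full u v ℓ
  IsPath⇒walk p = go _ (IsPath.starts p) (IsPath.ends p) (IsPath.linked p)
    where
    go : ∀ {u v ℓ} xs → head xs ≡ just u → last xs ≡ just v → Linked Adj xs → length xs ≡ suc ℓ →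
         Walk Full u v ℓ
    go (x ∷ []) refl refl _ _ = stop tt
    go {ℓ = suc ℓ} (x ∷ y ∷ xs) refl last≡ (e ∷ es) len =
      step tt e (go (y ∷ xs) refl last≡ es (suc-injective len))

  path⇒HasPath : ∀ {u v xs} → Path u v xs → ∃ λ ℓ → suc ℓ ≡ length xs × HasPath G u v ℓ
  path⇒HasPath {xs = xs} π@single       = _ , refl , xs , refl , path⇒IsPath π
  path⇒HasPath {xs = xs} π@(cons _ _ _) = _ , refl , xs , refl , path⇒IsPath π

  -- Repetitions can be cut out of a walk. Hence `walk?` with bound `n` decides reachability inside
  -- a decidable predicate.
  shorten : ∀ {P : Pred V 0ℓ} {u v ℓ} → Walk P u v ℓ → Walk P u v n
  shorten w with walk⇒path w
  ... | xs , π , ps , _ = lengthen (unique⇒length≤ xs (IsPath.unique (path⇒IsPath π))) (go π ps)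
    where
    go : ∀ {P u v xs} → Path u v xs → All P xs → Walk P u v (length xs)
    go single       (p ∷ [])  = stop p
    go (cons e π _) (p ∷ ps) = step p e (go π ps)

  connected⁺ : ∀ (S : Subset n) {u} → u Subset.∈ S →
               (∀ {v} → v Subset.∈ S → ∃ (Walk (Subset._∈ S) v u)) → Connected G S
  connected⁺ S {u} u∈ to-u = (u , u∈) , λ v w v∈ w∈ →
    let xs , π , ps , _ = walk⇒path (proj₂ (to-u v∈) ◅◅ reverse (proj₂ (to-u w∈)))
    in xs , path⇒IsPath π , ps

  distance-≤ : ∀ {u v d m} → IsDistance G u v d → Walk Full u v m → ∃ λ ℓ → d ≡ [ ℓ ]⁺ × ℓ ≤ m
  distance-≤ {d = d} isd w with walk⇒path w
  ... | xs , π , _ , len with path⇒HasPath π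
  distance-≤ {d = ⊤⁺}     none            w | _ , _ , _ , _   | ℓ , _ , p    = contradiction p (none ℓ)
  distance-≤ {d = [ d ]⁺} (_ , shortest) w | _ , _ , _ , len | ℓ , eq , p =
    d , refl , ≤-trans (shortest ℓ p) (≤-pred (≤-trans (≤-reflexive eq) len))

  distance-walk : ∀ {u v ℓ} → IsDistance G u v [ ℓ ]⁺ → Walk Full u v ℓ
  distance-walk ((xs , len , p) , _) = IsPath⇒walk p len

  Cap-> : ∀ {r d} → (∀ ℓ → d ≡ [ ℓ ]⁺ → ¬ ℓ ≤ r) → Cap r d ≡ ⊤⁺
  Cap-> {r} {⊤⁺}     _ = refl
  Cap-> {r} {[ ℓ ]⁺} far rewrite dec-false (ℓ ≤? r) (far ℓ refl) = refl

  cap-dist-far : ∀ {r a v} → ¬ Walk Full v a r → Cap r (dist G a v) ≡ ⊤⁺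
  cap-dist-far {r} {a} {v} none = Cap-> far
    where
    far : ∀ ℓ → dist G a v ≡ [ ℓ ]⁺ → ¬ ℓ ≤ r
    far ℓ eq ℓ≤r = none (reverse (lengthen ℓ≤r
      (distance-walk (subst (IsDistance G a v) eq (proj₂ (distance G a v))))))

  -- A capped distance is determined by the lengths `t ≤ r` for which a walk exists: with none at
  -- `r` both sides are infinite, and otherwise each distance bounds the other.
  cap-dist-cong : ∀ {r a v v′} →
                  (∀ {t} → t ≤ r → Walk Full v a t → Walk Full v′ a t) →
                  (∀ {t} → t ≤ r → Walk Full v′ a t → Walk Full v a t) →
                  Cap r (dist G a v) ≡ Cap r (dist G a v′)
  cap-dist-cong {r} {a} {v} {v′} to from with walk? (λ _ → yes tt) v a r
  ... | no none = trans (cap-dist-far none) (sym (cap-dist-far (none ∘ from ≤-refl)))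
  ... | yes w with distance-≤ (proj₂ (distance G a v)) (reverse w) | distance-≤ (proj₂ (distance G a v′)) (reverse (to ≤-refl w))
  ...   | ℓ , eq , ℓ≤r | ℓ′ , eq′ , ℓ′≤r = cong (Cap r) (trans eq (trans (cong [_]⁺ ℓ≡ℓ′) (sym eq′)))
    where
    below : ∀ {u u′ m m′} → dist G a u ≡ [ m ]⁺ → dist G a u′ ≡ [ m′ ]⁺ →
            (Walk Full u a m → Walk Full u′ a m) → m′ ≤ m
    below {u} {u′} e e′ f
      with distance-≤ (proj₂ (distance G a u′))
             (reverse (f (reverse (distance-walk (subst (IsDistance G a u) e (proj₂ (distance G a u)))))))
    ... | k , e″ , k≤m with refl ← trans (sym e′) e″ = k≤m
    ℓ≡ℓ′ : ℓ ≡ ℓ′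
    ℓ≡ℓ′ = ≤-antisym (below eq′ eq (from ℓ′≤r)) (below eq eq′ (to ℓ≤r))

-- Clique minors from power diagrams of balls

last-such : ∀ {P : ℕ → Set} → U.Decidable P → ∀ N → P 0 → ¬ P N → ∃ λ i → P i × ¬ P (suc i)
last-such P? zero    p ¬p = contradiction p ¬p
last-such P? (suc N) p ¬p with P? N
... | yes q = N , q , ¬p
... | no ¬q = last-such P? N p ¬q

-- Branch sets are the cells of the power diagram of the balls of radius t l around y l:
-- a vertex belongs to the ball it lies deepest inside, the first one in case of a tie.
module BallMinor {n : ℕ} (G : Graph n) {h : ℕ} (y : Fin h → Fin n) (t : Fin h → ℕ)
  (meet : ∀ i j → ∃ λ v → Walks.Walk G (Walks.Full G) v (y i) (t i) × Walks.Walk G (Walks.Full G) v (y j) (t j) ×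
          (∀ l → Walks.Walk G (Walks.Full G) v (y l) (t l) → l ≡ i ⊎ l ≡ j)) where
  open Walks G
  private V = Fin n

  -- The depth of `u` inside the ball `l` is at least `s`. The condition `s ≤ t l` keeps the
  -- subtraction from being truncated.
  Slack : Fin h → V → ℕ → Set
  Slack l u s = s ≤ t l × Walk Full u (y l) (t l ∸ s)

  slack? : ∀ l u s → Dec (Slack l u s)
  slack? l u s = (s ≤? t l) ×-dec walk? (λ _ → yes tt) u (y l) (t l ∸ s)

  slack-≤ : ∀ {l u s s′} → s′ ≤ s → Slack l u s → Slack l u s′
  slack-≤ {l} s′≤s (s≤ , w) = ≤-trans s′≤s s≤ , lengthen (∸-monoʳ-≤ (t l) s′≤s) w

  slack-back : ∀ {l u w s} → Adj w u → Slack l u (suc s) → Slack l w s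
  slack-back {l} {s = s} e (s< , π) = <⇒≤ s< ,
    lengthen (≤-reflexive (sym (+-∸-assoc 1 s<))) (step tt e π)

  slack-step : ∀ {l u s} → Slack l u s → u ≡ y l ⊎ ∃ λ w → Adj u w × Slack l w (suc s)
  slack-step {l} {u} {s} (s≤ , π) = go _ refl π
    where
    go : ∀ m → t l ∸ s ≡ m → Walk Full u (y l) m → u ≡ y l ⊎ ∃ λ w → Adj u w × Slack l w (suc s)
    go m eq (stop _) = inj₁ refl
    go (suc m) eq (step _ e w) = inj₂ (_ , e , s<t , lengthen (≤-reflexive m≡) w)
      where
      s<t : suc s ≤ t l
      s<t = m∸n≢0⇒n<m λ z → contradiction (trans (sym eq) z) λ ()
      m≡ : m ≡ t l ∸ suc s
      m≡ = suc-injective (trans (sym eq) (+-∸-assoc 1 s<t))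

  Wins : Fin h → V → ℕ → Set
  Wins i u s = Slack i u s × (∀ l → ¬ Slack l u (suc s)) × (∀ l → l Fin.< i → ¬ Slack l u s)

  Cell : Fin h → Pred V 0ℓ
  Cell i u = ∃ (Wins i u)

  cell? : ∀ i → U.Decidable (Cell i)
  cell? i u = map′
    (λ (s , win) → Fin.toℕ s , win)
    (λ (s , win@((s≤ , _) , _)) → Fin.fromℕ< (s≤s s≤) , subst (Wins i u) (sym (Fin.toℕ-fromℕ< (s≤s s≤))) win)
    (Fin.any? {suc (t i)} λ s → slack? i u (Fin.toℕ s) ×-dec
       Fin.all? (λ l → ¬? (slack? l u (suc (Fin.toℕ s)))) ×-dec
       Fin.all? (λ l → imp (l Fin.<? i) (¬? (slack? l u (Fin.toℕ s)))))
    where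
    imp : ∀ {A B : Set} → Dec A → Dec B → Dec (A → B)
    imp (yes a) b = map′ (λ x _ → x) (λ f → f a) b
    imp (no ¬a) _ = yes λ a → contradiction a ¬a

  cells-disjoint : ∀ {i j u} → Cell i u → Cell j u → i ≡ j
  cells-disjoint {i} {j} (s , Si , max , fst) (s′ , Sj , max′ , fst′) with <-cmp s s′
  ... | tri< s<s′ _ _ = contradiction (slack-≤ s<s′ Sj) (max j)
  ... | tri> _ _ s′<s = contradiction (slack-≤ s′<s Si) (max′ i)
  ... | tri≈ _ refl _ with Fin.<-cmp i j
  ...   | tri< i<j _ _ = contradiction Si (fst′ i i<j)
  ...   | tri≈ _ i≡j _ = i≡j
  ...   | tri> _ _ j<i = contradiction Sj (fst j j<i)

  winner : ∀ {l u s} → Slack l u s → ∃ λ i → Cell i u × Slack i u s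
  -- No slack exceeds the sum of all radii, so the search for the greatest slack at `u` is bounded.
  winner {l} {u} {s} S with last-such (λ d → Fin.any? (λ l → slack? l u (d + s))) (suc (t l + sumt)) (l , S) none
    where
    sumt : ℕ
    sumt = Vec.sum (Vec.tabulate t)
    bound : ∀ {h} (t : Fin h → ℕ) l → t l ≤ Vec.sum (Vec.tabulate t)
    bound t zero    = m≤m+n _ _
    bound t (suc l) = ≤-trans (bound (t ∘ suc) l) (m≤n+m _ _)
    none : ¬ ∃ λ l′ → Slack l′ u (suc (t l + sumt) + s)
    none (l′ , s≤ , _) = n≮n _ (≤-trans (s≤s (≤-trans (bound t l′) (≤-trans (m≤n+m sumt (t l)) (m≤m+n _ s)))) s≤)
  ... | d , (l₁ , S₁) , max = i , (d + s , Si , (λ l S → max (l , S)) , fst) , slack-≤ (m≤n+m s d) Si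
    where
    first : ∀ {m} {Q : Fin m → Set} → U.Decidable Q → ∃ Q → ∃ λ i → Q i × (∀ l → l Fin.< i → ¬ Q l)
    first {suc m} {Q} Q? (l , q) with Q? zero
    ... | yes q₀ = zero , q₀ , λ _ ()
    first {suc m} Q? (zero , q)  | no ¬q₀ = contradiction q ¬q₀
    first {suc m} {Q} Q? (suc l , q) | no ¬q₀ with first (Q? ∘ suc) (l , q)
    ... | i , qi , fst = suc i , qi , fst′
      where
      fst′ : ∀ l → l Fin.< suc i → ¬ Q l
      fst′ zero    _         = ¬q₀
      fst′ (suc l) (s≤s l<i) = fst l l<i
    chosen : ∃ λ i → Slack i u (d + s) × (∀ l → l Fin.< i → ¬ Slack l u (d + s))
    chosen = first (λ l → slack? l u (d + s)) (l₁ , S₁)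
    i : Fin h
    i = proj₁ chosen
    Si : Slack i u (d + s)
    Si = proj₁ (proj₂ chosen)
    fst : ∀ l → l Fin.< i → ¬ Slack l u (d + s)
    fst = proj₂ (proj₂ chosen)

  -- Along an edge no slack grows by more than one, so no ball overtakes `i` on a step where `i`
  -- gains one, and ties stay as they were.
  wins-step : ∀ {i u w s} → Adj u w → Slack i w (suc s) → Wins i u s → Wins i w (suc s)
  wins-step e S (_ , max , fst) = S , (λ l → max l ∘ slack-back e) , (λ l l<i → fst l l<i ∘ slack-back e)

  -- N bounds the number of remaining steps, since slack grows by one at each of them.
  to-centre : ∀ {i} N {u s} → t i ≤ N + s → Wins i u s → Walk (Cell i) u (y i) N
  to-centre {i} N {u} {s} bound win@(S , _) with slack-step S
  ... | inj₁ refl = stop (s , win)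
  to-centre zero    bound win | inj₂ (_ , _ , s< , _) = contradiction bound (<⇒≱ s<)
  to-centre (suc N) {s = s} bound win | inj₂ (w , e , S′) =
    step (_ , win) e (to-centre N (≤-trans bound (≤-reflexive (sym (+-suc N s)))) (wins-step e S′ win))

  -- Some vertex lies in the ball `i` alone, hence in its cell, and the walk from there to the
  -- centre never leaves the cell.
  centre∈ : ∀ i → Cell i (y i)
  centre∈ i with meet i i
  ... | v , w , _ , only with winner (z≤n , w)
  ...   | l , c , S with only l (proj₂ S)
  centre∈ i | v , w , _ , only | l , c , S | inj₁ refl =
    end∈ (to-centre (t l) (m≤m+n (t l) _) (proj₂ c))
  centre∈ i | v , w , _ , only | l , c , S | inj₂ refl =
    end∈ (to-centre (t l) (m≤m+n (t l) _) (proj₂ c))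

  -- Walk towards `y j`, where the slack of `j` grows by one each time. A ball with slack `suc s` at
  -- the next vertex has slack `s` at the present one, so the next vertex is in the cell of `i` or
  -- of `j`. The walk ends in the cell of `j`, so it crosses over at some edge.
  crossing : ∀ {i j} → i ≢ j → ∀ N {u s} → t j ≤ N + s → Slack j u s →
             (∀ l → Slack l u s → l ≡ i ⊎ l ≡ j) → Cell i u →
             ∃₂ λ u w → Cell i u × Cell j w × Adj u w
  crossing {i} {j} i≢j N bound S only c with slack-step S
  ... | inj₁ refl = contradiction (cells-disjoint c (centre∈ j)) i≢j
  crossing i≢j zero bound S only c | inj₂ (_ , _ , s< , _) = contradiction bound (<⇒≱ s<)
  crossing i≢j (suc N) {s = s} bound S only c | inj₂ (w , e , S′) with winner S′
  ... | l , c′ , T with only l (slack-back e T)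
  ...   | inj₁ refl = crossing i≢j N (≤-trans bound (≤-reflexive (sym (+-suc N s)))) S′
                        (λ l → only l ∘ slack-back e) c′
  ...   | inj₂ refl = _ , w , c , c′ , e

  touching : ∀ i j → i ≢ j → ∃₂ λ u w → Cell i u × Cell j w × Adj u w
  touching i j i≢j with meet i j
  ... | v , wi , wj , only with winner (z≤n , wi)
  ...   | l , c , S with only l (proj₂ S)
  ...     | inj₁ refl = crossing i≢j (t j) (m≤m+n (t j) 0) (z≤n , wj) (λ l → only l ∘ proj₂) c
  ...     | inj₂ refl with crossing (i≢j ∘ sym) (t i) (m≤m+n (t i) 0) (z≤n , wi) (λ l → swap ∘ only l ∘ proj₂) c
  ...       | u , w , cj , ci , e = w , u , ci , cj , symm e

  minor : complete h ≼ G
  minor = record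
    { branch    = λ i → ⟦ cell? i ⟧
    ; connected = λ i → connected⁺ _ (∈⟦⟧⁺ (cell? i) (centre∈ i)) λ v∈ →
        _ , walk-⊆ (∈⟦⟧⁺ (cell? i)) (to-centre (t i) (m≤m+n (t i) _) (proj₂ (∈⟦⟧⁻ (cell? i) v∈)))
    ; disjoint  = λ i j v v∈i v∈j → cells-disjoint (∈⟦⟧⁻ (cell? i) v∈i) (∈⟦⟧⁻ (cell? j) v∈j)
    ; edges     = λ i j i≢j → let u , w , ci , cj , e = touching i j i≢j in
        u , w , ∈⟦⟧⁺ (cell? i) ci , ∈⟦⟧⁺ (cell? j) cj , e
    }

-- Geodesics and the hulls built from them

module Hulls {n : ℕ} (G : Graph n) where
  open Walks G public
  private V = Fin n

  In : Subset n → Pred V 0ℓ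
  In S v = v Subset.∈ S

  module _ {P : Pred V 0ℓ} where

    verts : ∀ {u v ℓ} → Walk P u v ℓ → List V
    verts (stop {u} _)     = [ u ]
    verts (step {u} _ _ π) = u ∷ verts π

    start∈verts : ∀ {u v ℓ} (π : Walk P u v ℓ) → u ∈ verts π
    start∈verts (stop _)     = here refl
    start∈verts (step _ _ _) = here refl

    verts⊆ : ∀ {u v w ℓ} (π : Walk P u v ℓ) → w ∈ verts π → P w
    verts⊆ (stop p)     (here refl) = p
    verts⊆ (step p _ _) (here refl) = p
    verts⊆ (step _ _ π) (there w∈)  = verts⊆ π w∈

    verts-to-end : ∀ {u v w ℓ} (π : Walk P u v ℓ) → w ∈ verts π → Walk (λ x → x ∈ verts π × P x) w v ℓ
    verts-to-end (stop p)     (here refl) = stop (here refl , p)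
    verts-to-end (step p e π) (here refl) =
      step (here refl , p) e (walk-⊆ (λ (x∈ , q) → there x∈ , q) (verts-to-end π (start∈verts π)))
    verts-to-end (step _ _ π) (there w∈) =
      lengthen (n≤1+n _) (walk-⊆ (λ (x∈ , q) → there x∈ , q) (verts-to-end π w∈))

    Geodesic : V → V → ℕ → Set
    Geodesic u v ℓ = ∀ m → Walk P u v m → ℓ ≤ m

    late : ∀ {u v w ℓ} K (π : Walk P u v ℓ) → w ∈ verts π →
           w ∈ take (suc K) (verts π) ⊎ ∃ λ m → Walk P w v m × m + K < ℓ
    late K (stop _)     (here refl) = inj₁ (here refl)
    late K (step _ _ _) (here refl) = inj₁ (here refl)
    late {ℓ = suc ℓ} zero (step _ _ π) (there w∈) =
      inj₂ (_ , walk-⊆ proj₂ (verts-to-end π w∈) , s≤s (≤-reflexive (+-identityʳ ℓ)))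
    late (suc K) (step _ _ π) (there w∈) with late K π w∈
    ... | inj₁ w∈take       = inj₁ (there w∈take)
    ... | inj₂ (m , ρ , m<) = inj₂ (m , ρ , s≤s (≤-trans (≤-reflexive (+-suc m K)) m<))

    -- If `w` came later, going to it by the walk of length `K` would shorten the geodesic.
    near-start : ∀ {u v w ℓ K} (π : Walk P u v ℓ) → Geodesic u v ℓ → w ∈ verts π → Walk P u w K →
                 w ∈ take (suc K) (verts π)
    near-start {K = K} π geo w∈ σ with late K π w∈
    ... | inj₁ w∈take       = w∈take
    ... | inj₂ (m , ρ , m<) = contradiction (≤-trans m< (≤-trans (geo _ (σ ◅◅ ρ)) (≤-reflexive (+-comm K m)))) (n≮n _)

    -- Drop vertices from the front until one is within `ρ` of `x`. The others in the ball are
    -- within `ρ + ρ` of that one, so they are among the first `suc (ρ + ρ)` vertices of the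
    -- remaining geodesic.
    geodesic-ball : U.Decidable P → ∀ {u v ℓ} (π : Walk P u v ℓ) → Geodesic u v ℓ → ∀ x ρ →
                    Cover (λ w → w ∈ verts π × Walk P x w ρ) (suc (ρ + ρ))
    geodesic-ball P? (stop {u} _) _ x ρ = [ u ] , s≤s z≤n , proj₁
    geodesic-ball P? π@(step {u} p e π′) geo x ρ with walk? P? x u ρ
    ... | yes σ = take (suc (ρ + ρ)) (verts π) ,
      ≤-trans (≤-reflexive (length-take (suc (ρ + ρ)) (verts π))) (m⊓n≤m _ _) ,
      λ (w∈ , τ) → near-start π geo w∈ (reverse σ ◅◅ τ)
    ... | no ¬σ = cover-⊆ ≤-refl
      (λ { (here refl , τ) → contradiction τ ¬σ ; (there w∈ , τ) → w∈ , τ })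
      (geodesic-ball P? π′ (λ m σ → ≤-pred (geo (suc m) (step p e σ))) x ρ)

  Touches : Subset n → Subset n → Set
  Touches C B = ∃ λ w → In C w × ∃ λ u → In B u × Adj w u

  touches? : ∀ C B → Dec (Touches C B)
  touches? C B = Fin.any? λ w → (w ∈? C) ×-dec Fin.any? λ u → (u ∈? B) ×-dec (w adj? u)

  trail : Subset n → V → V → List V
  -- `least` looks strictly below its bound, so `suc n` includes the length `n` reached by
  -- `shorten`.
  trail C root w with least (λ ℓ → walk? (_∈? C) w root ℓ) (suc n)
  ... | inj₁ (_ , π , _) = verts π
  ... | inj₂ _           = []

  trail-geodesic : ∀ C {root w ℓ} → Walk (In C) w root ℓ →
    ∃₂ λ ℓ (π : Walk (In C) w root ℓ) → Geodesic w root ℓ × trail C root w ≡ verts π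
  trail-geodesic C {root} {w} σ with least (λ ℓ → walk? (_∈? C) w root ℓ) (suc n)
  ... | inj₁ (ℓ , π , geo) = ℓ , π , geo , refl
  ... | inj₂ none          = contradiction (shorten σ) (none n ≤-refl)

  -- The default `root` never arises in `hull-ends`, where the sets that `C` does not touch are
  -- filtered out.
  target : Subset n → V → Subset n → V
  target C root B with touches? C B
  ... | yes (w , _) = w
  ... | no  _       = root

  hull-ends : Subset n → V → List (Subset n) → List V
  hull-ends C root Bs = root ∷ map (target C root) (filter (touches? C) Bs)

  InHull : Subset n → V → List (Subset n) → Pred V 0ℓ
  InHull C root Bs v = Any (λ w → v ∈ trail C root w) (hull-ends C root Bs)

  inHull? : ∀ C root Bs → U.Decidable (InHull C root Bs)
  inHull? C root Bs v = Any.any? (λ w → v ∈ₗ? trail C root w) (hull-ends C root Bs)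

  -- The root is picked from `C` itself, so the hull depends on `C` and `Bs` only. This lets
  -- vertices of the same component share their hulls.
  hull : Subset n → List (Subset n) → Subset n
  hull C Bs with nonempty? C
  ... | yes (root , _) = ⟦ inHull? C root Bs ⟧
  ... | no  _          = Subset.⊥

  hull-nonempty : ∀ C Bs {v} → In (hull C Bs) v → Subset.Nonempty C
  hull-nonempty C Bs v∈ with nonempty? C
  ... | yes inhabited = inhabited
  ... | no  _         = contradiction v∈ ∉⊥

  record IsHull (C : Subset n) (Bs : List (Subset n)) (H : Subset n) : Set where
    field
      root    : V
      root∈   : In H root
      hull⊆   : ∀ {v} → In H v → In C v
      to-root : ∀ {v} → In H v → ∃ (Walk (In H) v root)
      touch   : ∀ {B} → B ∈ Bs → Touches C B → Touches H B
      -- One geodesic for each touched set, and the trivial one at `root`, account for `suc N`.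
      -- Distances are those of `C`, where the trails are shortest.
      ball    : ∀ {N} → length (filter (touches? C) Bs) ≤ N → ∀ x ρ →
                Cover (λ v → In H v × Walk (In C) x v ρ) (suc N * suc (ρ + ρ))

  Joined : Subset n → Set
  Joined C = ∀ {u v} → In C u → In C v → ∃ (Walk (In C) u v)

  hull-isHull : ∀ C Bs {v} → In C v → Joined C → IsHull C Bs (hull C Bs)
  hull-isHull C Bs v∈ joined with nonempty? C
  ... | no empty           = contradiction (_ , v∈) empty
  ... | yes (root , root∈C) = record
    { root    = root
    ; root∈   = ∈⟦⟧⁺ H? (root∈ root∈C)
    ; hull⊆   = proj₁ ∘ inside
    ; to-root = λ v∈ → proj₂ (inside v∈)
    ; touch   = touch
    ; ball    = ball
    }
    where
    ends : List V
    ends = hull-ends C root Bs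
    H? : U.Decidable (InHull C root Bs)
    H? = inHull? C root Bs
    H : Subset n
    H = ⟦ H? ⟧

    target∈ : ∀ B → In C (target C root B)
    target∈ B with touches? C B
    ... | yes (_ , w∈ , _) = w∈
    ... | no  _            = root∈C

    ends⊆ : ∀ {w} → w ∈ ends → In C w
    ends⊆ (here refl) = root∈C
    ends⊆ (there w∈) with ∈-map⁻ (target C root) w∈
    ... | B , _ , refl = target∈ B

    geodesic : ∀ {w} → In C w → ∃₂ λ ℓ (π : Walk (In C) w root ℓ) → Geodesic w root ℓ × trail C root w ≡ verts π
    geodesic w∈ = trail-geodesic C (proj₂ (joined w∈ root∈C))

    start∈trail : ∀ {w} → In C w → w ∈ trail C root w
    start∈trail {w} w∈ with geodesic w∈
    ... | _ , π , _ , eq = subst (w ∈_) (sym eq) (start∈verts π)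

    root∈ : In C root → InHull C root Bs root
    root∈ r∈ = here (start∈trail r∈)

    inside : ∀ {v} → In H v → In C v × ∃ (Walk (In H) v root)
    inside {v} v∈H with find (∈⟦⟧⁻ H? v∈H)
    ... | w , w∈ends , v∈trail with geodesic (ends⊆ w∈ends)
    ...   | ℓ , π , _ , eq with subst (v ∈_) eq v∈trail
    ...     | v∈π = verts⊆ π v∈π , ℓ ,
      walk-⊆ (λ {x} (x∈ , _) → ∈⟦⟧⁺ H? (lose w∈ends (subst (x ∈_) (sym eq) x∈))) (verts-to-end π v∈π)

    target-touches : ∀ B → Touches C B → ∃ λ u → In B u × Adj (target C root B) u
    target-touches B tch with touches? C B
    ... | yes (_ , _ , u) = u
    ... | no ¬tch         = contradiction tch ¬tch

    touch : ∀ {B} → B ∈ Bs → Touches C B → Touches H B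
    touch {B} B∈ tch = target C root B ,
      ∈⟦⟧⁺ H? (lose (there (∈-map⁺ (target C root) (∈-filter⁺ (touches? C) B∈ tch))) (start∈trail (target∈ B))) ,
      target-touches B tch

    ball : ∀ {N} → length (filter (touches? C) Bs) ≤ N → ∀ x ρ →
           Cover (λ v → In H v × Walk (In C) x v ρ) (suc N * suc (ρ + ρ))
    ball N≥ x ρ = cover-⊆
      (*-monoˡ-≤ (suc (ρ + ρ)) (s≤s (≤-trans (≤-reflexive (length-map (target C root) (filter (touches? C) Bs))) N≥)))
      (λ (v∈H , τ) → let w , w∈ends , v∈trail = find (∈⟦⟧⁻ H? v∈H) in
        w , w∈ends , ends⊆ w∈ends , v∈trail , τ)
      (cover-list {Q = λ w v → In C w × v ∈ trail C root w × Walk (In C) x v ρ} ends λ w → cover-when (w ∈? C) λ w∈ →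
        let _ , π , geo , eq = geodesic w∈ in
        cover-⊆ ≤-refl (λ {v} (v∈ , τ) → subst (v ∈_) eq v∈ , τ) (geodesic-ball (_∈? C) π geo x ρ))

-- The chain of components and hulls of a vertex

length-filter-applyDownFrom : ∀ {A : Set} {P : A → Set} (P? : U.Decidable P) (f : ℕ → A) i →
  length (filter P? (applyDownFrom f i)) ≡ length (filter (P? ∘ f) (downFrom i))
length-filter-applyDownFrom P? f zero = refl
length-filter-applyDownFrom P? f (suc i) with does (P? (f i))
... | true  = cong suc (length-filter-applyDownFrom P? f i)
... | false = length-filter-applyDownFrom P? f i

lookup-mono : ∀ {A : Set} {R : A → A → Set} {xs} → AllPairs R xs → ∀ {i j} → i Fin.< j →
              R (lookup xs i) (lookup xs j)
lookup-mono (r ∷ _)  {zero}  {suc j} _         = All.lookup r (∈-lookup j)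
lookup-mono (_ ∷ rs) {suc i} {suc j} (s≤s i<j) = lookup-mono rs i<j

module Components {n : ℕ} (G : Graph n) where
  open Hulls G public
  private V = Fin n

  module _ {P : Pred V 0ℓ} (P? : U.Decidable P) where

    comp : V → Subset n
    comp v = ⟦ (λ u → walk? P? v u n) ⟧

    ∈comp⁺ : ∀ {u v ℓ} → Walk P v u ℓ → In (comp v) u
    ∈comp⁺ {v = v} π = ∈⟦⟧⁺ (λ u → walk? P? v u n) (shorten π)

    ∈comp⁻ : ∀ {u v} → In (comp v) u → Walk P v u n
    ∈comp⁻ {v = v} = ∈⟦⟧⁻ (λ u → walk? P? v u n)

    comp-joined : ∀ v → Joined (comp v)
    comp-joined v u∈ w∈ = _ , reverse (stay (∈comp⁻ u∈)) ◅◅ stay (∈comp⁻ w∈)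
      where
      go : ∀ {x u k ℓ} → Walk P v x k → Walk P x u ℓ → Walk (In (comp v)) x u ℓ
      go ρ (stop _)     = stop (∈comp⁺ ρ)
      go ρ (step p e π) = step (∈comp⁺ ρ) e (go (ρ ◅◅ step {ℓ = 0} p e (stop (start∈ π))) π)
      stay : ∀ {u ℓ} → Walk P v u ℓ → Walk (In (comp v)) v u ℓ
      stay π = go (stop {ℓ = 0} (start∈ π)) π

    comp-closed : ∀ {u v w} → In (comp v) u → Adj u w → P w → In (comp v) w
    comp-closed u∈ e p = let π = ∈comp⁻ u∈ in ∈comp⁺ (π ◅◅ step {ℓ = 0} (end∈ π) e (stop p))

    comp-cong : ∀ {u v} → In (comp v) u → comp u ≡ comp v
    comp-cong {u} {v} u∈ = ⟦⟧-cong (λ w → walk? P? u w n) (λ w → walk? P? v w n) λ w →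
      mk⇔ (λ π → shorten (∈comp⁻ u∈ ◅◅ π)) (λ π → shorten (reverse (∈comp⁻ u∈) ◅◅ π))

  -- The current component together with the hulls removed so far, latest first.
  State : Set
  State = Subset n × List (Subset n)

  hullₛ : State → Subset n
  hullₛ (C , Bs) = hull C Bs

  rest? : ∀ s → U.Decidable (λ u → In (proj₁ s) u × ¬ In (hullₛ s) u)
  rest? s u = (u ∈? proj₁ s) ×-dec ¬? (u ∈? hullₛ s)

  -- Once `v` lies in the hull, no walk of the remainder starts at `v`: this component and all later
  -- ones are empty, and the chain can run over all natural numbers.
  next : State → V → State
  next s v = comp (rest? s) v , hullₛ s ∷ proj₂ s

  state : V → ℕ → State
  state v zero    = comp {P = Full} (λ _ → yes tt) v , []
  state v (suc i) = next (state v i) v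

  module Chain (v : V) where

    C H : ℕ → Subset n
    C i = proj₁ (state v i)
    H i = hullₛ (state v i)

    C-joined : ∀ i → Joined (C i)
    C-joined zero    = comp-joined {P = Full} (λ _ → yes tt) v
    C-joined (suc i) = comp-joined (rest? (state v i)) v

    C-rest : ∀ i {u} → In (C (suc i)) u → In (C i) u × ¬ In (H i) u
    C-rest i u∈ = end∈ (∈comp⁻ (rest? (state v i)) {v = v} u∈)

    C-mono : ∀ {i j u} → i ≤ j → In (C j) u → In (C i) u
    C-mono {i} {zero}  z≤n u∈ = u∈
    C-mono {i} {suc j} i≤1+j u∈ with m≤n⇒m<n∨m≡n i≤1+j
    ... | inj₁ (s≤s i≤j) = C-mono i≤j (proj₁ (C-rest j u∈))
    ... | inj₂ refl      = u∈

    removed : ∀ i → proj₂ (state v i) ≡ applyDownFrom H i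
    removed zero    = refl
    removed (suc i) = cong (H i ∷_) (removed i)

    isHull : ∀ {i u} → In (C i) u → IsHull (C i) (proj₂ (state v i)) (H i)
    isHull {i} u∈ = hull-isHull (C i) _ u∈ (C-joined i)

    H⊆C : ∀ i {u} → In (H i) u → In (C i) u
    H⊆C i u∈ = IsHull.hull⊆ (isHull {i} (proj₂ (hull-nonempty (C i) _ u∈))) u∈

    H∩C : ∀ {i j u} → j < i → In (H j) u → ¬ In (C i) u
    H∩C {j = j} j<i u∈H u∈C = proj₂ (C-rest j (C-mono j<i u∈C)) u∈H

    stays : ∀ i → In (C i) v → ¬ In (H i) v → In (C (suc i)) v
    stays i v∈C v∉H = ∈comp⁺ (rest? (state v i)) (stop {ℓ = 0} (v∈C , v∉H))

    stays-or-leaves : ∀ i → In (C i) v → In (H i) v ⊎ In (C (suc i)) v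
    stays-or-leaves i v∈C = map₂ (stays i v∈C) (toSum (v ∈? H i))

    start : In (C 0) v
    start = ∈comp⁺ {P = Full} (λ _ → yes tt) (stop {ℓ = 0} tt)

    -- The next component is closed under edges inside `C i` minus `H i`, so an edge that leaves it
    -- ends in `H i` or leaves `C i` as well.
    boundary : ∀ i {u w} → In (C i) u → Adj u w → In (C i) w ⊎ ∃ λ j → j < i × In (H j) w
    boundary zero u∈ e = inj₁ (comp-closed {P = Full} (λ _ → yes tt) {v = v} u∈ e tt)
    boundary (suc i) {w = w} u∈ e with boundary i (proj₁ (C-rest i u∈)) e
    ... | inj₂ (j , j<i , w∈) = inj₂ (j , m≤n⇒m≤1+n j<i , w∈)
    ... | inj₁ w∈C with w ∈? H i
    ...   | yes w∈H = inj₂ (i , ≤-refl , w∈H)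
    ...   | no  w∉H = inj₁ (comp-closed (rest? (state v i)) {v = v} u∈ e (w∈C , w∉H))

    -- Each level loses at least the root of its hull.
    C-size : ∀ i {u} → In (C i) u → i + Subset.∣ C i ∣ ≤ n
    C-size zero    _  = ∣p∣≤n (C 0)
    C-size (suc i) u∈ = ≤-trans (≤-reflexive (sym (+-suc i _)))
      (≤-trans (+-monoʳ-≤ i (p⊂q⇒∣p∣<∣q∣ (proj₁ ∘ C-rest i , root , H⊆C i root∈ , λ r∈ → proj₂ (C-rest i r∈) root∈)))
        (C-size i (proj₁ (C-rest i u∈))))
      where open IsHull (isHull {i} (proj₁ (C-rest i u∈)))

    C-empty : ∀ {u} → ¬ In (C (suc n)) u
    C-empty u∈ = n≮n _ (≤-trans (m≤m+n (suc n) _) (C-size (suc n) u∈))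

    J : ℕ → ℕ → Set
    J i j = j < i × Touches (C i) (H j)

    touches-mono : ∀ {i k} j → k ≤ i → Touches (C i) (H j) → Touches (C k) (H j)
    touches-mono _ k≤i (w , w∈ , t) = w , C-mono k≤i w∈ , t

    -- Components shrink along the chain, so a hull touching `C i` also touches the larger `C k`;
    -- this is the clique condition.
    open Descent J (λ i j → (j <? i) ×-dec touches? (C i) (H j)) proj₁
      (λ {_} {j} (j<i , t) (k<i , _) j<k → j<k , touches-mono j (<⇒≤ k<i) t) public

    -- Here `w` is the first vertex of the walk outside `C i`. The prefix, `w` included, lies in
    -- `C j`, and the strict bound `m′<ℓ` records that leaving costs an edge.
    record Exit (i : ℕ) (P : Pred V 0ℓ) (u x : V) (ℓ : ℕ) : Set where
      constructor exit
      field
        {j m m′} : ℕ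
        {w}      : V
        j<i      : j < i
        touching : Touches (C i) (H j)
        w∈       : In (H j) w
        m+m′≤ℓ   : m + m′ ≤ ℓ
        m′<ℓ     : m′ < ℓ
        prefix   : Walk (In (C j)) u w m
        suffix   : Walk P w x m′

    first-exit : ∀ i {P u x ℓ} → In (C i) u → Walk P u x ℓ → Walk (In (C i)) u x ℓ ⊎ Exit i P u x ℓ
    first-exit i u∈ (stop _) = inj₁ (stop u∈)
    first-exit i u∈ (step _ e π) with boundary i u∈ e
    ... | inj₂ (j , j<i , w∈) = inj₂ (exit {m = 1} j<i (_ , u∈ , _ , w∈ , e) w∈ ≤-refl ≤-refl
                                  (step (C-mono (<⇒≤ j<i) u∈) e (stop (H⊆C j w∈))) π)
    ... | inj₁ w∈ with first-exit i w∈ π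
    ...   | inj₁ ρ = inj₁ (step u∈ e ρ)
    ...   | inj₂ (exit j<i t y∈ m+m′≤ m′< ρ σ) =
      inj₂ (exit j<i t y∈ (s≤s m+m′≤) (m≤n⇒m≤1+n m′<) (step (C-mono (<⇒≤ j<i) u∈) e ρ) σ)

    -- For `j < i` the end of the walk is outside `C i`, so the walk exits into a hull that `C i`
    -- touches. This is a step of `J` and uses up at least one edge; the rest of the walk is handled
    -- in the same way.
    walk⇒descends : ∀ ℓ {i j z x} → In (H i) z → In (H j) x → Walk (In (C j)) z x ℓ → Descends ℓ i j
    walk⇒descends ℓ {i} {j} z∈ x∈ π with <-cmp i j
    ... | tri< i<j _ _  = contradiction (start∈ π) (H∩C i<j z∈)
    ... | tri≈ _ refl _ = here
    ... | tri> _ _ j<i with first-exit i (H⊆C i z∈) π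
    ...   | inj₁ ρ = contradiction (end∈ ρ) (H∩C j<i x∈)
    walk⇒descends (suc ℓ) {i} {j} z∈ x∈ π | tri> _ _ j<i | inj₂ (exit k<i t w∈ _ (s≤s m′≤ℓ) _ σ) =
      down (k<i , t) (walk⇒descends ℓ {_} {j} w∈ x∈ (lengthen m′≤ℓ σ))

    home : ∃ λ i → In (H i) v
    home with last-such (λ i → v ∈? C i) (suc n) start C-empty
    ... | i , v∈ , v∉ = i , decidable-stable (v ∈? H i) (v∉ ∘ stays i v∈)

    neighbours : ℕ → List ℕ
    neighbours i = filter (λ j → touches? (C i) (H j)) (downFrom i)

    neighbours⁻ : ∀ {i j} → j ∈ neighbours i → J i j
    neighbours⁻ {i} j∈ with ∈-filter⁻ (λ j → touches? (C i) (H j)) {xs = downFrom i} j∈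
    ... | j∈ , t = ∈-downFrom⁻ j∈ , t

    -- The earlier hull `H j` touches `C k`, which contains `C i`, and `H k` was built to reach
    -- every earlier hull touching `C k`.
    hulls-touch : ∀ {i j k} → J i j → J i k → j < k → Touches (H k) (H j)
    hulls-touch {i} {j} {k} (_ , w , w∈ , t) (k<i , _) j<k =
      IsHull.touch (isHull {k} w∈Ck) (subst (H j ∈_) (sym (removed k)) (∈-applyDownFrom⁺ H j<k)) (w , w∈Ck , t)
      where
      w∈Ck : In (C k) w
      w∈Ck = C-mono (<⇒≤ k<i) w∈

    touches-sym : ∀ {S T} → Touches S T → Touches T S
    touches-sym (u , u∈ , w , w∈ , e) = w , w∈ , u , u∈ , symm e

    -- C i and the hulls it touches are branch sets of a complete minor.
    neighbours-minor : ∀ i {u} → In (C i) u → ∀ {N} → N ≤ length (neighbours i) → complete (suc N) ≼ G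
    neighbours-minor i {u} u∈ {N} N≤ = record
      { branch = branch ; connected = connected ; disjoint = disjoint
      ; edges  = λ a b a≢b → let u , u∈ , w , w∈ , e = touch a b a≢b in u , w , u∈ , w∈ , e }
      where
      pick : Fin N → ℕ
      pick a = lookup (neighbours i) (Fin.inject≤ a N≤)
      pick∈ : ∀ a → J i (pick a)
      pick∈ a = neighbours⁻ (∈-lookup (Fin.inject≤ a N≤))
      ordered : ∀ {a b} → a Fin.< b → pick b < pick a
      ordered {a} {b} a<b = lookup-mono {R = _>_}
        (AllPairs.filter⁺ (λ j → touches? (C i) (H j)) (AllPairs.applyDownFrom⁺₁ (λ x → x) i (λ q<p _ → q<p)))
        (subst₂ _<_ (sym (Fin.toℕ-inject≤ a N≤)) (sym (Fin.toℕ-inject≤ b N≤)) a<b)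

      branch : Fin (suc N) → Subset n
      branch zero    = C i
      branch (suc a) = H (pick a)

      connected : ∀ a → Connected G (branch a)
      connected zero    = connected⁺ _ u∈ λ w∈ → C-joined i w∈ u∈
      connected (suc a) = connected⁺ _ root∈ to-root
        where open IsHull (isHull {pick a} (C-mono (<⇒≤ (proj₁ (pick∈ a))) u∈))

      disjoint : ∀ a b w → In (branch a) w → In (branch b) w → a ≡ b
      disjoint zero    zero    w _   _   = refl
      disjoint zero    (suc b) w w∈C w∈H = contradiction w∈C (H∩C (proj₁ (pick∈ b)) w∈H)
      disjoint (suc a) zero    w w∈H w∈C = contradiction w∈C (H∩C (proj₁ (pick∈ a)) w∈H)
      disjoint (suc a) (suc b) w w∈a w∈b with Fin.<-cmp a b
      ... | tri≈ _ a≡b _ = cong suc a≡b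
      ... | tri< a<b _ _ = contradiction (H⊆C (pick a) w∈a) (H∩C (ordered a<b) w∈b)
      ... | tri> _ _ b<a = contradiction (H⊆C (pick b) w∈b) (H∩C (ordered b<a) w∈a)

      touch : ∀ a b → a ≢ b → Touches (branch a) (branch b)
      touch zero    zero    a≢b = contradiction refl a≢b
      touch zero    (suc b) _   = proj₂ (pick∈ b)
      touch (suc a) zero    _   = touches-sym (proj₂ (pick∈ a))
      touch (suc a) (suc b) a≢b with Fin.<-cmp a b
      ... | tri≈ _ a≡b _ = contradiction (cong suc a≡b) a≢b
      ... | tri< a<b _ _ = hulls-touch (pick∈ b) (pick∈ a) (ordered a<b)
      ... | tri> _ _ b<a = touches-sym (hulls-touch (pick∈ a) (pick∈ b) (ordered b<a))

    module _ {N : ℕ} (minor-free : ¬ complete (2 + N) ≼ G) where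

      degree : ∀ i {u} → In (C i) u → length (neighbours i) ≤ N
      -- With `suc N` touched hulls, adding `C i` would give `2 + N` branch sets.
      degree i u∈ = ≮⇒≥ λ N< → minor-free (neighbours-minor i u∈ N<)

      J-cover : ∀ i → Cover (J i) N
      J-cover i with nonempty? (C i)
      ... | no empty      = [] , z≤n , λ (_ , w , w∈ , _) → contradiction (w , w∈) empty
      ... | yes (_ , u∈) = neighbours i , degree i u∈ ,
        λ (j<i , t) → ∈-filter⁺ (λ j → touches? (C i) (H j)) (∈-downFrom⁺ j<i) t

      ball : ∀ i x ρ → Cover (λ u → In (H i) u × Walk (In (C i)) x u ρ) (suc N * suc (ρ + ρ))
      ball i x ρ = cover-⊆ ≤-refl (λ (u∈ , π) → (_ , H⊆C i u∈) , u∈ , π)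
        (cover-when (nonempty? (C i)) λ (_ , u∈) → IsHull.ball (isHull {i} u∈) (≤-trans (≤-reflexive
          (trans (cong (length ∘ filter (touches? (C i))) (removed i))
            (length-filter-applyDownFrom (touches? (C i)) H i))) (degree i u∈)) x ρ)

      -- The weakly r-reachable vertices of v.
      reach-cover : ∀ r → Cover (λ (i , x) → In (H i) x × Walk (In (C i)) v x r)
                                (suc r ^ N * (suc N * suc (r + r)))
      reach-cover r = cover-⊆ ≤-refl
        (λ { {i , x} (x∈ , π) → i , (z≤n , walk⇒descends r {proj₁ home} {i} (proj₂ home) x∈ π) , x , (x∈ , π) , refl })
        (cover-bind
          (descent-cover r N 0 (λ _ → ⊤) (λ _ _ _ → tt) (λ {i} _ → cover-⊆ ≤-refl proj₁ (J-cover i)) tt)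
          (λ i → cover-image (i ,_) (ball i v r)))

      -- The radius is `r + r` because `x` and the guards are each within `r` of the vertex to be
      -- guarded. Centring at `x` makes the set the same for all vertices of the component that
      -- share `x`.
      Guard : ℕ → V → ℕ → V → Set
      Guard i x r y = ∃ λ j → (j ≡ i ⊎ J i j) × In (H j) y × Walk (In (C j)) x y (r + r)

      guard-cover : ∀ i x r → Cover (Guard i x r) (suc N * (suc N * suc ((r + r) + (r + r))))
      guard-cover i x r = cover-bind (cover-∪ ([ i ] , ≤-refl , here) (J-cover i)) (λ j → ball j x (r + r))

  -- A state determines its hull and so the remainder of its component; `u` and `v` lie in one
  -- component of that remainder.
  state-cong : ∀ {u v} i → In (Chain.C v i) u → state u i ≡ state v i
  state-cong {u} {v} zero    u∈ = cong (_, []) (comp-cong {P = Full} (λ _ → yes tt) {v = v} u∈)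
  state-cong {u} {v} (suc i) u∈ =
    trans (cong (λ s → next s u) (state-cong i (proj₁ (Chain.C-rest v i u∈))))
          (cong (_, _) (comp-cong (rest? (state v i)) {v = v} u∈))

-- Guard sets that meet all short walks to `A`

module Guards {n : ℕ} (G : Graph n) (A : Subset n) (r : ℕ) where
  open Components G public
  private V = Fin n

  Guarded : List V → V → Set
  Guarded ys v = ∀ {a t} → In A a → t ≤ r → Walk Full v a t →
    ∃ λ y → y ∈ ys × ∃₂ λ m m′ → m + m′ ≤ t × Walk Full v y m × Walk Full y a m′

  module _ {N : ℕ} (minor-free : ¬ complete (2 + N) ≼ G) (v : V) where

    open Chain v

    Near : ℕ → Set
    Near i = ∃ λ a → In A a × Walk (In (C i)) v a r

    near? : ∀ i → Dec (Near i)
    near? i = Fin.any? λ a → (a ∈? A) ×-dec walk? (_∈? C i) v a r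

    near₀ : ∀ {a} → In A a → Walk Full v a r → Near 0
    near₀ {a} a∈ π with first-exit 0 start π
    ... | inj₁ ρ = a , a∈ , ρ
    ... | inj₂ e with () ← Exit.j<i e

    last-near : ∀ {a} → In A a → Walk Full v a r → ∃ λ i → Near i × ¬ Near (suc i)
    last-near a∈ π = last-such near? (suc n) (near₀ a∈ π) λ (a , _ , ρ) → C-empty (start∈ ρ)

    Gate : ℕ → V → V → Set
    Gate i a x = In (H i) x × Walk (In (C i)) v x r × Walk (In (C i)) x a r

    -- If `v` is outside `H i`, the walk cannot stay in `C (suc i)`, where `A` is no longer near. It
    -- exits into some `H j` with `j ≤ i`, and since it runs in `C i`, only `j = i` is possible.
    gate : ∀ {i a} → In A a → Walk (In (C i)) v a r → ¬ Near (suc i) → ∃ (Gate i a)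
    gate {i} {a} a∈ π far with stays-or-leaves i (start∈ π)
    ... | inj₁ v∈H = v , v∈H , stop (start∈ π) , π
    ... | inj₂ v∈C with first-exit (suc i) v∈C π
    ...   | inj₁ ρ = contradiction (a , a∈ , ρ) far
    ...   | inj₂ (exit {j} {m} {m′} {w} (s≤s j≤i) _ w∈ m+m′≤r _ ρ σ) with m≤n⇒m<n∨m≡n j≤i
    ...     | inj₁ j<i  = contradiction (start∈ σ) (H∩C j<i w∈)
    ...     | inj₂ refl = w , w∈ , lengthen (≤-trans (m≤m+n m m′) m+m′≤r) ρ ,
                          lengthen (≤-trans (m≤n+m m′ m) m+m′≤r) σ

    -- A vertex `v` of `H i` is its own guard. Otherwise a short walk to `A` must leave `C (suc i)`,
    -- and its first vertex outside is the guard `y`, reached from `x` by going through `v` inside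
    -- `C j`.
    passes : ∀ {i a x} → Gate i a x → ¬ Near (suc i) → ∀ {b t} → In A b → t ≤ r → Walk Full v b t →
             ∃ λ y → Guard minor-free i x r y × ∃₂ λ m m′ → m + m′ ≤ t × Walk Full v y m × Walk Full y b m′
    passes {i} {a} {x} (x∈ , ρ , _) far {b} {t} b∈ t≤r π with stays-or-leaves i (start∈ ρ)
    ... | inj₁ v∈H = v , (i , inj₁ refl , v∈H , lengthen (m≤m+n r r) (reverse ρ)) ,
                    0 , t , ≤-refl , stop tt , π
    ... | inj₂ v∈C with first-exit (suc i) v∈C π
    ...   | inj₁ σ = contradiction (b , b∈ , lengthen t≤r σ) far
    ...   | inj₂ (exit {j} {m} {m′} {y} (s≤s j≤i) touching y∈ m+m′≤t _ σ τ) =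
      y , (j , level , y∈ , walk-⊆ (C-mono j≤i) (reverse ρ) ◅◅ lengthen (≤-trans (m≤m+n m m′) (≤-trans m+m′≤t t≤r)) σ) ,
      m , m′ , m+m′≤t , walk-⊆ (λ _ → tt) σ , τ
      where
      level : j ≡ i ⊎ J i j
      level with m≤n⇒m<n∨m≡n j≤i
      ... | inj₁ j<i  = inj₂ (j<i , touches-mono j (n≤1+n i) touching)
      ... | inj₂ refl = inj₁ refl

  module _ {N : ℕ} (minor-free : ¬ complete (2 + N) ≼ G) where

    abstract
      -- The list is taken from the chain of `a` and not of the guarded vertex, so that it depends
      -- on `a`, `i` and `x` alone and can be counted by them.
      guards : V → ℕ → V → List V
      guards a i x = proj₁ (Chain.guard-cover a minor-free i x r)

      length-guards : ∀ a i x → length (guards a i x) ≤ suc N * (suc N * suc ((r + r) + (r + r)))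
      length-guards a i x = proj₁ (proj₂ (Chain.guard-cover a minor-free i x r))

      ∈guards : ∀ {a i x y} → Chain.Guard a minor-free i x r y → y ∈ guards a i x
      ∈guards {a} {i} {x} = proj₂ (proj₂ (Chain.guard-cover a minor-free i x r))

    -- The chains of v and a agree up to the level i at which a lies in the component of v.
    guard-transfer : ∀ {v a i x y} → In (Chain.C v i) a →
                     Chain.Guard v minor-free i x r y → Chain.Guard a minor-free i x r y
    guard-transfer {v} {a} {i} {x} {y} a∈ (j , level , y∈ , π) =
      j , level′ level , subst (λ s → In (hullₛ s) y × Walk (In (proj₁ s)) x y (r + r)) (agree j≤i) (y∈ , π)
      where
      agree : ∀ {k} → k ≤ i → state v k ≡ state a k
      agree {k} k≤i = sym (state-cong {a} {v} k (Chain.C-mono v k≤i a∈))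
      level≤ : j ≡ i ⊎ Chain.J v i j → j ≤ i
      level≤ (inj₁ refl)      = ≤-refl
      level≤ (inj₂ (j<i , _)) = <⇒≤ j<i
      j≤i : j ≤ i
      j≤i = level≤ level
      level′ : j ≡ i ⊎ Chain.J v i j → j ≡ i ⊎ Chain.J a i j
      level′ (inj₁ eq) = inj₁ eq
      level′ (inj₂ (j<i , t)) = inj₂ (j<i ,
        subst (λ s → Touches (proj₁ s) (Chain.H a j)) (agree ≤-refl)
          (subst (λ s → Touches (Chain.C v i) (hullₛ s)) (agree (<⇒≤ j<i)) t))

    Reaches : V → ℕ × V → Set
    Reaches a (i , x) = In (Chain.H a i) x × Walk (In (Chain.C a i)) a x r

    guarded : ∀ {v a} → In A a → Walk Full v a r →
              ∃ λ a → In A a × ∃₂ λ i x → Reaches a (i , x) × Guarded (guards a i x) v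
    guarded {v} a∈ π with last-near minor-free v a∈ π
    -- The given vertex of `A` only shows that the search can start; it is replaced by one that `v`
    -- reaches inside the last near component.
    ... | i , (a , a∈ , ρ) , far with gate minor-free v {i} a∈ ρ far
    ...   | x , g@(x∈ , _ , σ) = a , a∈ , i , x ,
      subst (λ s → In (hullₛ s) x × Walk (In (proj₁ s)) a x r) (sym (state-cong {a} {v} i (end∈ ρ))) (x∈ , reverse σ) ,
      λ b∈ t≤r τ → let y , gd , rest = passes minor-free v {i} {a} g far b∈ t≤r τ in
        y , ∈guards {a} {i} {x} (guard-transfer {v} {a} {i} (end∈ ρ) gd) , rest

-- Traces of vertices on a guard set

does-true : ∀ {A : Set} (A? : Dec A) → does A? ≡ true → A
does-true (yes a) _ = a

map-≡⇒agree : ∀ {A B : Set} {f g : A → B} {x} (xs : List A) →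
              Vec.map f (Vec.fromList xs) ≡ Vec.map g (Vec.fromList xs) → x ∈ xs → f x ≡ g x
map-≡⇒agree (x ∷ xs) eq (here refl) = Vec.∷-injectiveˡ eq
map-≡⇒agree (x ∷ xs) eq (there x∈)  = map-≡⇒agree xs (Vec.∷-injectiveʳ eq) x∈

length-cartesianProduct : ∀ {A B : Set} (xs : List A) (ys : List B) →
                          length (cartesianProduct xs ys) ≡ length xs * length ys
length-cartesianProduct []       ys = refl
length-cartesianProduct (x ∷ xs) ys = trans (length-++ (List.map (x ,_) ys))
  (cong₂ _+_ (length-map (x ,_) ys) (length-cartesianProduct xs ys))

subset-cover : ∀ {n} (A : Subset n) → Cover (λ v → v Subset.∈ A) Subset.∣ A ∣
subset-cover []            = [] , z≤n , λ { {()} }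
subset-cover (Subset.outside ∷ A) = cover-⊆ ≤-refl (λ { (Vec.there v∈) → _ , v∈ , refl })
  (cover-image suc (subset-cover A))
subset-cover (Subset.inside ∷ A)  = cover-⊆ ≤-refl (λ { Vec.here → inj₁ refl ; (Vec.there v∈) → inj₂ (_ , v∈ , refl) })
  (cover-∪ ([ zero ] , ≤-refl , here) (cover-image suc (subset-cover A)))

deduplicate-distinct : ∀ {A : Set} {ℓ} {_≈_ : A → A → Set ℓ} (_≈?_ : Decidable _≈_) xs →
                       AllPairs (λ x y → ¬ x ≈ y) (deduplicate _≈?_ xs)
deduplicate-distinct _≈?_ []       = []
deduplicate-distinct _≈?_ (x ∷ xs) =
  All.all-filter (¬? ∘ (x ≈?_)) (deduplicate _≈?_ xs) ∷ AllPairs.filter⁺ (¬? ∘ (x ≈?_)) (deduplicate-distinct _≈?_ xs)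

deduplicate-all : ∀ {A : Set} {ℓ} {_≈_ : A → A → Set ℓ} (_≈?_ : Decidable _≈_) {P : A → Set} {xs} →
                  All P xs → All P (deduplicate _≈?_ xs)
deduplicate-all _≈?_ []       = []
deduplicate-all _≈?_ (p ∷ ps) = p ∷ All.filter⁺ (¬? ∘ (_ ≈?_)) (deduplicate-all _≈?_ ps)

module Traces {n : ℕ} (G : Graph n) (r : ℕ) where
  open Walks G
  private V = Fin n

  -- One bit for each guard and each radius up to `r`: capped distances become thresholds, and
  -- profiles become members of a set system of balls.
  points : List V → List (V × ℕ)
  points ys = cartesianProduct ys (upTo (suc r))

  length-points : ∀ ys → length (points ys) ≡ length ys * suc r
  length-points ys = trans (length-cartesianProduct ys (upTo (suc r))) (cong (length ys *_) (length-upTo (suc r)))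

  within? : ∀ v ((y , t) : V × ℕ) → Dec (Walk Full v y t)
  within? v (y , t) = walk? (λ _ → yes tt) v y t

  trace : ∀ ys → V → Vec Bool (length (points ys))
  trace ys v = Vec.map (does ∘ within? v) (Vec.fromList (points ys))

  trace-walk : ∀ ys {v v′ y t} → trace ys v ≡ trace ys v′ → y ∈ ys → t ≤ r →
               Walk Full v y t → Walk Full v′ y t
  trace-walk ys {v} {v′} {y} {t} eq y∈ t≤r π = does-true (within? v′ (y , t))
    (trans (sym (map-≡⇒agree (points ys) eq (∈-cartesianProduct⁺ y∈ (∈-upTo⁺ (s≤s t≤r)))))
      (dec-true (within? v (y , t)) π))

  Traced : ∀ ys → Vec Bool (length (points ys)) → Set
  Traced ys x = ∃ λ v → trace ys v ≡ x

  -- The pattern that is true exactly at `i` and `j` is realised by a vertex in these two balls and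
  -- no other, as `BallMinor` demands; `i = j` is included.
  shattered-minor : ∀ ys {h} (is : Vec (Fin (length (points ys))) h) → Shatters (Traced ys) is →
                    complete h ≼ G
  shattered-minor ys {h} is shatters = BallMinor.minor G (proj₁ ∘ point) (proj₂ ∘ point) meet
    where
    point : Fin h → V × ℕ
    point l = Vec.lookup (Vec.fromList (points ys)) (Vec.lookup is l)

    one-of? : ∀ i j (l : Fin h) → Dec (l ≡ i ⊎ l ≡ j)
    one-of? i j l = (l Fin.≟ i) ⊎-dec (l Fin.≟ j)

    meet : ∀ i j → ∃ λ v → Walk Full v (proj₁ (point i)) (proj₂ (point i)) ×
                           Walk Full v (proj₁ (point j)) (proj₂ (point j)) ×
                           (∀ l → Walk Full v (proj₁ (point l)) (proj₂ (point l)) → l ≡ i ⊎ l ≡ j)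
    meet i j with shatters (Vec.tabulate (does ∘ one-of? i j))
    ... | x , (v , refl) , eq = v , near i (inj₁ refl) , near j (inj₂ refl) , only
      where
      agree : ∀ l → does (within? v (point l)) ≡ does (one-of? i j l)
      agree l =
        trans (sym (Vec.lookup-map (Vec.lookup is l) _ (Vec.fromList (points ys))))
        (trans (sym (Vec.lookup-map l (Vec.lookup x) is))
        (trans (cong (λ z → Vec.lookup z l) eq) (Vec.lookup∘tabulate _ l)))
      near : ∀ l → l ≡ i ⊎ l ≡ j → Walk Full v (proj₁ (point l)) (proj₂ (point l))
      near l l∈ = does-true (within? v (point l)) (trans (agree l) (dec-true (one-of? i j l) l∈))
      only : ∀ l → Walk Full v (proj₁ (point l)) (proj₂ (point l)) → l ≡ i ⊎ l ≡ j
      only l π = does-true (one-of? i j l) (trans (sym (agree l)) (dec-true (within? v (point l)) π))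

  trace-cover : ∀ {d} → ¬ complete (suc d) ≼ G → ∀ {S} ys → length ys ≤ S →
                Cover (Traced ys) (suc (S * suc r) ^ d)
  trace-cover {d} minor-free ys len = cover-⊆ bound (λ t → t)
    (sauer-shelah _ (suc d) (Traced ys) (λ x → Fin.any? λ v → Vec.≡-dec Bool._≟_ (trace ys v) x)
      λ is → minor-free ∘ shattered-minor ys is)
    where
    bound = ≤-trans (sauer≤ (length (points ys)) d)
      (^-monoˡ-≤ d (s≤s (≤-trans (≤-reflexive (length-points ys)) (*-monoˡ-≤ (suc r) len))))

-- Counting profiles by keys

module Counting {n : ℕ} (G : Graph n) (A : Subset n) (r N : ℕ) (minor-free : ¬ complete (2 + N) ≼ G) where
  open Guards G A r
  open Traces G r
  private V = Fin n

  -- The guard list itself, not the triple it came from, is stored: it is all that is needed to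
  -- recover the profile.
  Key : Set
  Key = Σ (List V) λ ys → Vec Bool (length (points ys))

  HasKey : Profile A → Key → Set
  HasKey p (ys , x) = ∃ λ v → p ≗ profile r G v A × Guarded ys v × trace ys v ≡ x

  guards′ : V → ℕ × V → List V
  guards′ a (i , x) = guards minor-free a i x

  GoodKey : Key → Set
  GoodKey κ = ∃ λ a → In A a × ∃ λ ix → Reaches minor-free a ix ×
              ∃ λ x → Traced (guards′ a ix) x × κ ≡ (guards′ a ix , x)

  key-cover : Cover GoodKey (Subset.∣ A ∣ * (suc r ^ N * (suc N * suc (r + r)) *
    suc (suc N * (suc N * suc ((r + r) + (r + r))) * suc r) ^ suc N))
  key-cover = cover-bind (subset-cover A) λ a →
    cover-bind (Chain.reach-cover a minor-free r) λ (i , x) →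
    cover-image (guards′ a (i , x) ,_)
      (trace-cover minor-free (guards′ a (i , x)) (length-guards minor-free a i x))

  -- A short walk from `v` to `a` splits at a guard `y`. By equality of traces `v′` reaches `y`
  -- within the same length, and the rest of the walk is kept.
  same-key : ∀ {p q κ} → HasKey p κ → HasKey q κ → p ≗ q
  same-key {κ = ys , _} (v , p≗ , gv , tv) (v′ , q≗ , gv′ , tv′) (a , a∈) =
    trans (p≗ (a , a∈)) (trans (cap-dist-cong (go gv (trans tv (sym tv′))) (go gv′ (trans tv′ (sym tv))))
      (sym (q≗ (a , a∈))))
    where
    go : ∀ {v v′} → Guarded ys v → trace ys v ≡ trace ys v′ → ∀ {t} → t ≤ r → Walk Full v a t → Walk Full v′ a t
    go g eq t≤r π with g a∈ t≤r π
    ... | y , y∈ , m , m′ , m+m′≤t , ρ , σ = lengthen m+m′≤t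
      (trace-walk ys eq y∈ (≤-trans (m≤m+n m m′) (≤-trans m+m′≤t t≤r)) ρ ◅◅ σ)

  close : ∀ v → ¬ (profile r G v A ≗ λ _ → ⊤⁺) → ∃ λ a → In A a × Walk Full v a r
  close v nontrivial = decidable-stable (Fin.any? λ a → (a ∈? A) ×-dec within? v (a , r))
    λ none → nontrivial λ (a , a∈) → cap-dist-far λ π → none (a , a∈ , π)

  guards-key : ∀ {v b i x} → In A b → Reaches minor-free b (i , x) → Guarded (guards minor-free b i x) v →
               ∃ λ κ → GoodKey κ × HasKey (profile r G v A) κ
  guards-key {v} {b} {i} {x} b∈ reach g =
    key , (b , b∈ , (i , x) , reach , proj₂ key , (v , refl) , refl) , v , (λ _ → refl) , g , refl
    where
    key : Key
    key = guards minor-free b i x , trace (guards minor-free b i x) v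

  has-key : ∀ v → ¬ (profile r G v A ≗ λ _ → ⊤⁺) → ∃ λ κ → GoodKey κ × HasKey (profile r G v A) κ
  has-key v nontrivial =
    let a , a∈ , π = close v nontrivial
        b , b∈ , i , x , reach , g = guarded minor-free a∈ π
    in guards-key b∈ reach g

  pcₛ-bound : pcₛ r G A ≤ Subset.∣ A ∣ * (suc r ^ N * (suc N * suc (r + r)) *
    suc (suc N * (suc N * suc ((r + r) + (r + r))) * suc r) ^ suc N)
  pcₛ-bound = pigeonhole {_≈_ = _≗_} {Key = HasKey} (λ {p} {q} {κ} → same-key {p} {q} {κ}) GoodKey key-cover _
    (deduplicate-distinct _≗?_ _)
    (deduplicate-all _≗?_ (All.zipWith keyed
      (All.all-filter nontrivial? profiles , All.filter⁺ nontrivial? (All.map⁺ (All.tabulate {xs = allFin n} (λ {v} _ → v , refl))))))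
    where
    profiles : List (Profile A)
    profiles = List.map (λ v → profile r G v A) (allFin n)
    nontrivial? : ∀ p → Dec (¬ (p ≗ λ _ → ⊤⁺))
    nontrivial? p = ¬? (p ≗? λ _ → ⊤⁺)
    keyed : ∀ {p} → ¬ (p ≗ λ _ → ⊤⁺) × (∃ λ v → p ≡ profile r G v A) → ∃ λ κ → GoodKey κ × HasKey p κ
    keyed (nt , v , refl) = has-key v nt

-- Arithmetic of the final bound

^-distribʳ-* : ∀ a b m → (a * b) ^ m ≡ a ^ m * b ^ m
^-distribʳ-* a b zero    = refl
^-distribʳ-* a b (suc m) = trans (cong (a * b *_) (^-distribʳ-* a b m)) (lemma a b (a ^ m) (b ^ m))
  where
  lemma : ∀ a b x y → a * b * (x * y) ≡ a * x * (b * y)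
  lemma = solve-∀

module _ (N r : ℕ) (2≤N : 2 ≤ N) (1≤r : 1 ≤ r) where
  private
    h = 2 + N

    4≤h : 4 ≤ h
    4≤h = s≤s (s≤s 2≤N)

    absorb : ∀ a b {c} → a + b ≤ c → a * r + b ≤ c * r
    absorb a b {c} a+b≤c = begin
      a * r + b     ≡⟨ cong (a * r +_) (sym (*-identityʳ b)) ⟩
      a * r + b * 1 ≤⟨ +-monoʳ-≤ (a * r) (*-monoʳ-≤ b 1≤r) ⟩
      a * r + b * r ≡⟨ sym (*-distribʳ-+ r a b) ⟩
      (a + b) * r   ≤⟨ *-monoˡ-≤ r a+b≤c ⟩
      c * r         ∎
      where open ≤-Reasoning

    r+1≤ : ∀ {c} → 2 ≤ c → suc r ≤ c * r
    r+1≤ {c} 2≤c = ≤-trans (≤-reflexive (lemma r)) (absorb 1 1 2≤c)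
      where
      lemma : ∀ r → suc r ≡ 1 * r + 1
      lemma = solve-∀

    2r+1≤ : suc (r + r) ≤ h * r
    2r+1≤ = ≤-trans (≤-reflexive (lemma r)) (absorb 2 1 (≤-trans (n≤1+n 3) 4≤h))
      where
      lemma : ∀ r → suc (r + r) ≡ 2 * r + 1
      lemma = solve-∀

    4r+1≤ : suc ((r + r) + (r + r)) ≤ 5 * r
    4r+1≤ = ≤-trans (≤-reflexive (lemma r)) (absorb 4 1 ≤-refl)
      where
      lemma : ∀ r → suc ((r + r) + (r + r)) ≡ 4 * r + 1
      lemma = solve-∀

    trace-size : suc (suc N * (suc N * suc ((r + r) + (r + r))) * suc r) ≤ h ^ 4 * (r * r)
    trace-size = begin
      suc (suc N * (suc N * suc ((r + r) + (r + r))) * suc r)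
        ≤⟨ s≤s (*-mono-≤ (*-mono-≤ (n≤1+n (suc N)) (*-mono-≤ (n≤1+n (suc N)) 4r+1≤)) (r+1≤ {2} ≤-refl)) ⟩
      1 + h * (h * (5 * r)) * (2 * r)
        ≤⟨ +-monoˡ-≤ _ (*-mono-≤ (*-mono-≤ 1≤h 1≤h) (*-mono-≤ 1≤r 1≤r)) ⟩
      h * h * (r * r) + h * (h * (5 * r)) * (2 * r)
        ≡⟨ lemma₁ h r ⟩
      11 * (h * h * (r * r))
        -- The constant `11 = 1 + 5 * 2` is absorbed by `11 ≤ 16 ≤ h * h`.
        ≤⟨ *-monoˡ-≤ (h * h * (r * r)) (≤-trans (m≤m+n 11 5) (*-mono-≤ 4≤h 4≤h)) ⟩
      h * h * (h * h * (r * r))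
        ≡⟨ lemma₂ h r ⟩
      h ^ 4 * (r * r) ∎
      where
      open ≤-Reasoning
      1≤h : 1 ≤ h
      1≤h = s≤s z≤n
      lemma₁ : ∀ h r → h * h * (r * r) + h * (h * (5 * r)) * (2 * r) ≡ 11 * (h * h * (r * r))
      lemma₁ = solve-∀
      lemma₂ : ∀ h r → h * h * (h * h * (r * r)) ≡ (h * (h * (h * (h * 1)))) * (r * r)
      lemma₂ = solve-∀

  -- The exponent of `r` collects `N` from the descents, `1` from the ball in a hull and `2 * suc N`
  -- from the traces, which is `3 * h ∸ 3` in all. That of `h` collects `N`, `2` and `4 * suc N` in
  -- the same way.
  arithmetic : suc r ^ N * (suc N * suc (r + r)) *
               suc (suc N * (suc N * suc ((r + r) + (r + r))) * suc r) ^ suc N ≤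
               h ^ (5 * h) * r ^ (3 * h ∸ 3)
  arithmetic = begin
    suc r ^ N * (suc N * suc (r + r)) * suc (suc N * (suc N * suc ((r + r) + (r + r))) * suc r) ^ suc N
      ≤⟨ *-mono-≤ (*-mono-≤ (^-monoˡ-≤ N (r+1≤ {h} (s≤s (s≤s z≤n)))) (*-mono-≤ (n≤1+n (suc N)) 2r+1≤))
           (^-monoˡ-≤ (suc N) trace-size) ⟩
    (h * r) ^ N * (h * (h * r)) * (h ^ 4 * (r * r)) ^ suc N
      ≡⟨ cong₂ _*_ (cong (_* (h * (h * r))) (^-distribʳ-* h r N))
           (trans (^-distribʳ-* (h ^ 4) (r * r) (suc N))
             (cong₂ _*_ (^-*-assoc h 4 (suc N)) (^-distribʳ-* r r (suc N)))) ⟩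
    h ^ N * r ^ N * (h * (h * r)) * (h ^ (4 * suc N) * (r ^ suc N * r ^ suc N))
      ≡⟨ lemma h r (h ^ N) (r ^ N) (h ^ (4 * suc N)) (r ^ suc N) ⟩
    (h * (h * h ^ N)) * h ^ (4 * suc N) * (r ^ suc N * (r ^ suc N * r ^ suc N))
      ≡⟨ cong₂ _*_ (sym (^-distribˡ-+-* h (2 + N) (4 * suc N)))
           (sym (trans (^-distribˡ-+-* r (suc N) _) (cong (r ^ suc N *_) (^-distribˡ-+-* r (suc N) (suc N))))) ⟩
    h ^ ((2 + N) + 4 * suc N) * r ^ (suc N + (suc N + suc N))
      ≤⟨ *-mono-≤ (^-monoʳ-≤ h exponent) (≤-reflexive (cong (r ^_) (sym exponent-r))) ⟩
    h ^ (5 * h) * r ^ (3 * h ∸ 3) ∎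
    where
    open ≤-Reasoning
    lemma : ∀ h r x y z w → x * y * (h * (h * r)) * (z * (w * w)) ≡ (h * (h * x)) * z * (r * y * (w * w))
    lemma = solve-∀
    exponent : (2 + N) + 4 * suc N ≤ 5 * h
    exponent = ≤-trans (m≤m+n _ 4) (≤-reflexive (lemma′ N))
      where
      lemma′ : ∀ N → (2 + N) + 4 * suc N + 4 ≡ 5 * (2 + N)
      lemma′ = solve-∀
    exponent-r : 3 * h ∸ 3 ≡ suc N + (suc N + suc N)
    exponent-r = trans (cong (_∸ 3) (lemma′ N)) (m+n∸n≡m _ 3)
      where
      lemma′ : ∀ N → 3 * (2 + N) ≡ suc N + (suc N + suc N) + 3
      lemma′ = solve-∀

theorem8 : ∃₂ λ (C c : ℕ) → C > 0 × c > 0 ×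
    (∀ (h r : ℕ) → h ≥ 4 → r ≥ 1 →
    ∀ (n : ℕ) (G : Graph n) → ¬ (complete h ≼ G) →
    ∀ (k : ℕ) → 1 ≤ k → k ≤ n →
    pc r G k ≤ C * h ^ (c * h) * r ^ (3 * h ∸ 3) * k)
theorem8 = 1 , 5 , s≤s z≤n , s≤s z≤n , bound
  where
  open ≤-Reasoning
  bound : ∀ (h r : ℕ) → h ≥ 4 → r ≥ 1 → ∀ (n : ℕ) (G : Graph n) → ¬ (complete h ≼ G) →
          ∀ (k : ℕ) → 1 ≤ k → k ≤ n → pc r G k ≤ 1 * h ^ (5 * h) * r ^ (3 * h ∸ 3) * k
  bound (suc (suc N)) r (s≤s (s≤s 2≤N)) 1≤r n G minor-free k _ _ =
    -- Here `z≤n` bounds the default value `0` of `max`.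
    max≤v⁺ z≤n (All.map⁺ (All.map each (All.all-filter (λ A → Subset.∣ A ∣ ≟ k) (subsets n))))
    where
    h = 2 + N
    each : ∀ {A} → Subset.∣ A ∣ ≡ k → pcₛ r G A ≤ 1 * h ^ (5 * h) * r ^ (3 * h ∸ 3) * k
    each {A} refl = begin
      pcₛ r G A                                ≤⟨ Counting.pcₛ-bound G A r N minor-free ⟩
      k * _                                    ≤⟨ *-monoʳ-≤ k (arithmetic N r 2≤N 1≤r) ⟩
      k * (h ^ (5 * h) * r ^ (3 * h ∸ 3))      ≡⟨ *-comm k _ ⟩
      h ^ (5 * h) * r ^ (3 * h ∸ 3) * k        ≡⟨ cong (λ z → z * r ^ (3 * h ∸ 3) * k) (sym (*-identityˡ (h ^ (5 * h)))) ⟩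
      1 * h ^ (5 * h) * r ^ (3 * h ∸ 3) * k    ∎
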